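{- For integers $0\leq k\leq n$, \[ (1-q)^{n-k}S_1[n,k] = \sum_{j=0}^{n-k} \sum_{i=j}^{n-k} (-1)^j\, B^{n+1,k+1}_{i,j}\, q^{i + \binom{j}2} \begin{bmatrix} i\\ j\end{bmatrix}_q . \]
   Context: $q$-binomial coefficients: $[i]_q=1+q+\dots+q^{i-1}$, $[n]_q!=[1]_q\cdots[n]_q$, $\begin{bmatrix} n\\ k\end{bmatrix}_q=\frac{[n]_q!}{[k]_q![n-k]_q!}$ for $0\leq k\leq n$, and $0$ if $k<0$ or $k>n$. For integers $N,K$ and $i,j$, \[ B^{N,K}_{i,j}=\binom{N+j-1}{K-1}\binom{N-i-1}{K-1}-\binom{N+j}{K-1}\binom{N-i-2}{K-1}, \] which also equals $\frac{i+j+1}{N+j}\binom{N+j}{K-1}\binom{N-i-2}{K-2}$; here the conventions $\binom{ -2}{ -2}=\binom{ -1}{ -1}=1$ and $\binom{u}{v}=0$ if $v<0$ and $u>v$ are used. For $n\geq 0$ let $\mathfrak{S}_n$ be the set of permutations of $\{1,\dots,n\}$. For $\sigma\in\mathfrak{S}_n$, a right-to-left maximum is an index $i$ such that $\sigma(i)>\sigma(j)$ for all $j$ with $i<j\leq n$; let $\mathrm{rlm}(\sigma)$ be their number. An inversion of $\sigma$ is a pair $(i,j)$ with $i<j$ and $\sigma(i)>\sigma(j)$; it is special if there exists $k'$ with $j<k'\leq n$ and $\sigma(i)<\sigma(k')$. Let $\mathrm{inv}'(\sigma)$ be the number of special inversions. Define $S_1[n,k]=\sum_{\sigma} q^{\mathrm{inv}'(\sigma)}$,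 summed over $\sigma\in\mathfrak{S}_n$ with $\mathrm{rlm}(\sigma)=k$. -}

module Defs where

open import Data.Nat as ℕ using (ℕ; zero; suc; _∸_)
open import Data.Nat.Combinatorics using (_C_)
open import Data.Integer as ℤ using (ℤ; +_; -[1+_])
open import Data.Fin using (Fin; _<_)
open import Data.Fin.Properties using (all?; any?; _<?_; _≟_)
open import Data.Vec using (Vec; []; _∷_; lookup)
open import Data.List as L using (List; []; _∷_; [_]; map; concatMap; filter; length; foldr; allFin)
open import Data.Product using (_×_; _,_)
open import Relation.Nullary.Decidable using (Dec; _→-dec_; _×-dec_)
open import Relation.Binary.PropositionalEquality using (_≡_)

-- Polynomials in q with integer coefficients: coefficient lists
-- (lowest degree first); equality means equality of all coefficients.

Poly : Set
Poly = List ℤ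

coeff : Poly → ℕ → ℤ
coeff []       _       = + 0
coeff (a ∷ p)  zero    = a
coeff (a ∷ p)  (suc m) = coeff p m

infix 4 _≈_
_≈_ : Poly → Poly → Set
p ≈ r = ∀ m → coeff p m ≡ coeff r m

infixl 6 _⊕_
_⊕_ : Poly → Poly → Poly
[]      ⊕ r       = r
p       ⊕ []      = p
(a ∷ p) ⊕ (b ∷ r) = (a ℤ.+ b) ∷ (p ⊕ r)

infixl 7 _·_
_·_ : ℤ → Poly → Poly
c · p = map (c ℤ.*_) p

infixl 7 _⊗_
_⊗_ : Poly → Poly → Poly
[]      ⊗ r = []
(a ∷ p) ⊗ r = (a · r) ⊕ (+ 0 ∷ (p ⊗ r))

const : ℤ → Poly
const c = [ c ]

one : Poly
one = const (+ 1)

qpow : ℕ → Poly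
qpow zero    = one
qpow (suc m) = + 0 ∷ qpow m

_^ₚ_ : Poly → ℕ → Poly
p ^ₚ zero  = one
p ^ₚ suc m = p ⊗ (p ^ₚ m)

oneMinusQ : Poly
oneMinusQ = + 1 ∷ ℤ.- (+ 1) ∷ []

sumₚ : List Poly → Poly
sumₚ = foldr _⊕_ []

range : ℕ → ℕ → List ℕ
range a b = L.map (a ℕ.+_) (L.upTo (suc b ∸ a))

qint : ℕ → Poly
qint i = sumₚ (L.map qpow (L.upTo i))

qfact : ℕ → Poly
qfact zero    = one
qfact (suc n) = qint (suc n) ⊗ qfact n

-- Qb is the q-binomial coefficient [i choose j]_q = [i]_q!/([j]_q![i-j]_q!)
-- for 0 ≤ j ≤ i, characterised as the quotient (Z[q] is a domain, so
-- the quotient is unique when it exists).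
IsQBinom : (ℕ → ℕ → Poly) → Set
IsQBinom Qb = ∀ i j → j ℕ.≤ i → (qfact j ⊗ qfact (i ∸ j)) ⊗ Qb i j ≈ qfact i

-- Binomial coefficients on integers with the paper's conventions:
-- ordinary binomial for u, v ≥ 0; (-1 choose -1) = (-2 choose -2) = 1;
-- 0 otherwise (in particular 0 if v < 0 and u > v).

binomℤ : ℤ → ℤ → ℤ
binomℤ (+ u)          (+ v)          = + (u C v)
binomℤ -[1+ 0 ]       -[1+ 0 ]       = + 1
binomℤ -[1+ 1 ]       -[1+ 1 ]       = + 1
binomℤ _              _              = + 0

B : ℤ → ℤ → ℤ → ℤ → ℤ
B N K i j =
  binomℤ (N ℤ.+ j ℤ.- + 1) (K ℤ.- + 1) ℤ.* binomℤ (N ℤ.- i ℤ.- + 1) (K ℤ.- + 1)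
  ℤ.- binomℤ (N ℤ.+ j) (K ℤ.- + 1) ℤ.* binomℤ (N ℤ.- i ℤ.- + 2) (K ℤ.- + 1)

-- Permutations of an n-element set, as injective words σ : Vec (Fin n) n
-- (values 0..n-1 instead of 1..n; the statistics only use the order).

words : (len m : ℕ) → List (Vec (Fin m) len)
words zero    m = [ [] ]
words (suc l) m = concatMap (λ x → L.map (x ∷_) (words l m)) (allFin m)

Injective : ∀ {n} → Vec (Fin n) n → Set
Injective {n} σ = ∀ (i j : Fin n) → lookup σ i ≡ lookup σ j → i ≡ j

injective? : ∀ {n} (σ : Vec (Fin n) n) → Dec (Injective σ)
injective? σ = all? λ i → all? λ j → (lookup σ i ≟ lookup σ j) →-dec (i ≟ j)

perms : (n : ℕ) → List (Vec (Fin n) n)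
perms n = filter injective? (words n n)

IsRLM : ∀ {n} → Vec (Fin n) n → Fin n → Set
IsRLM {n} σ i = ∀ (j : Fin n) → i < j → lookup σ j < lookup σ i

isRLM? : ∀ {n} (σ : Vec (Fin n) n) (i : Fin n) → Dec (IsRLM σ i)
isRLM? σ i = all? λ j → (i <? j) →-dec (lookup σ j <? lookup σ i)

rlm : ∀ {n} → Vec (Fin n) n → ℕ
rlm {n} σ = length (filter (isRLM? σ) (allFin n))

IsSpecialInv : ∀ {n} → Vec (Fin n) n → Fin n × Fin n → Set
IsSpecialInv {n} σ (i , j) =
  i < j × lookup σ j < lookup σ i
  × (Data.Product.∃ λ (k′ : Fin n) → j < k′ × lookup σ i < lookup σ k′)

isSpecialInv? : ∀ {n} (σ : Vec (Fin n) n) (p : Fin n × Fin n) → Dec (IsSpecialInv σ p)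
isSpecialInv? σ (i , j) =
  (i <? j) ×-dec (lookup σ j <? lookup σ i)
  ×-dec any? (λ k′ → (j <? k′) ×-dec (lookup σ i <? lookup σ k′))

allPairs : (n : ℕ) → List (Fin n × Fin n)
allPairs n = L.cartesianProduct (allFin n) (allFin n)

inv′ : ∀ {n} → Vec (Fin n) n → ℕ
inv′ {n} σ = length (filter (isSpecialInv? σ) (allPairs n))

S₁ : ℕ → ℕ → Poly
S₁ n k = sumₚ (L.map (λ σ → qpow (inv′ σ)) (filter (λ σ → rlm σ ℕ.≟ k) (perms n)))

{-# OPTIONS --safe #-}
module Submission where

-- Read a permutation letter by letter and charge each special inversion to its smaller letter; the
-- charge counts the earlier letters that are larger, but not larger than everything still to come.
-- Summed over all sets of used letters, this process only remembers the number h of used letters.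
-- Up to powers of 1 − q, the resulting generating functions g_h (with z marking the letters that are
-- not right-to-left maxima, and a those that are) are determined by
--   g_{h+1} = g_h + a g_{h+1} + z (1 − qʰ⁺¹) (g_{h+2} − g_{h+1}),   g₀ = 1.
-- This recurrence has the explicit solution
--   g_{h+1} = ∑ᵢ (q z v)ⁱ [h + i, i]_q vʰ⁺¹ (1 − v) (1 − q v) ⋯ (1 − qⁱ⁻¹ v),   v = 1 + v (a + z (v − 1)),
-- and the B-numbers are the coefficients of the powers of v, so that g₁ gives the formula.

open import Defs hiding (_≈_)
open import Data.Nat as ℕ using (ℕ; zero; suc; _≤_; _<_; _∸_; z≤n; s≤s; z<s; s<s; s<s⁻¹)
import Data.Nat.Properties as ℕ
open import Data.Nat.Combinatorics using (_C_; nCn≡1; nC1≡n; k>n⇒nCk≡0; nCk≡nC[n∸k]; nCk+nC[k+1]≡[n+1]C[k+1])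
open import Data.Integer as ℤ using (ℤ; +_; -1ℤ)
import Data.Integer.Properties as ℤ
open import Data.Integer.Solver using (module +-*-Solver)
open import Data.List as L using (List; []; _∷_; _++_; map; foldr; filter; length; concatMap; allFin; tabulate; cartesianProduct; upTo)
import Data.List.Properties as L
open import Data.Bool using (Bool; true; false; if_then_else_; not; _∧_; T)
open import Data.Fin as Fin using (Fin; zero; suc; toℕ; opposite; inject₁; fromℕ)
open import Data.Fin.Properties as Fin using (all?; any?; _<?_)
open import Data.Maybe using (Maybe; just; nothing)
open import Data.Product using (_×_; _,_; ∃; proj₁; proj₂)
open import Data.Unit using (tt)
open import Data.Vec as Vec using (Vec; []; _∷_; lookup; _[_]≔_; replicate)
import Data.Vec.Properties as Vec
open import Algebra.Bundles using (CommutativeRing)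
open import Algebra.Solver.Ring.AlmostCommutativeRing using (fromCommutativeRing; _-Raw-AlmostCommutative⟶_)
import Algebra.Solver.Ring
import Algebra.Properties.Semiring.Exp
open import Function using (_∘_; id; mk⇔)
open import Level using (0ℓ)
open import Relation.Binary using (Setoid; tri<; tri≈; tri>)
import Relation.Binary.Reasoning.Setoid as SetoidReasoning
open import Relation.Nullary using (Dec; yes; no; does; contradiction)
open import Relation.Nullary.Decidable using (does-⇔; dec-true; dec-false; _→-dec_; _×-dec_)
open import Relation.Unary using (Pred; Decidable)
open import Relation.Binary.PropositionalEquality as ≡ using (_≡_)

-- The difference g_{h+2} - g_{h+1} comes from a case distinction on the largest letter. Once used,
-- it exceeds everything to come and can be forgotten. While it is free, no other letter becomes a
-- right-to-left maximum, and each is charged for all larger used letters. Summed over all patterns,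
-- these charges run through 0, ..., h and give [h + 1], which one factor 1 - q turns into 1 - qʰ⁺¹.
-- So 1 - q is spent once for each letter that is not a right-to-left maximum, n - k times in all.
-- The recurrence fixes the series degree by degree, hence the solution has only to be verified. Its
-- single terms do not satisfy the recurrence; their errors telescope, thanks to the absorption
-- identities of Gaussian binomials. The equation of v enters as vᵖ⁺¹ + z vᵖ⁺¹ = vᵖ + a vᵖ⁺¹ + z
-- vᵖ⁺², a relation between coefficients given in closed form. The q-binomials of the statement are
-- known only as quotients and are identified by cancelling q-factorials, whose constant coefficient
-- is 1.

module Ballots where

  -- Coefficients of the powers of v, and the numbers B.

  open ≡ using (refl; sym; trans; cong; cong₂)

  -- Abstract, because _C_ reduces to a quotient of factorials when its arguments are successors.
  abstract
    binom : ℕ → ℕ → ℤ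
    binom n k = + (n C k)

    binom-def : ∀ n k → + (n C k) ≡ binom n k
    binom-def n k = refl

    binom-zero : ∀ n → binom n 0 ≡ + 1
    binom-zero n = cong +_ (trans (nCk≡nC[n∸k] {n = n} ℕ.z≤n) (nCn≡1 n))

    binom-diag : ∀ n → binom n n ≡ + 1
    binom-diag n = cong +_ (nCn≡1 n)

    binom-above : ∀ n → binom n (suc n) ≡ + 0
    binom-above n = cong +_ (k>n⇒nCk≡0 (ℕ.n<1+n n))

    pascal : ∀ n k → binom (suc n) (suc k) ≡ binom n k ℤ.+ binom n (suc k)
    pascal n k = trans (cong +_ (sym (nCk+nC[k+1]≡[n+1]C[k+1] n k))) (ℤ.pos-+ (n C k) (n C suc k))

  -- A determinant of binomials that gives the Narayana numbers for p = 0. With m = N - 1 + k it is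
  -- the coefficient of zᴺ aᵏ in vᵖ⁺¹.
  ballot : ℕ → ℕ → ℕ → ℤ
  ballot p m k = binom (suc (m ℕ.+ p)) k ℤ.* binom (suc m) k
           ℤ.- binom (suc (suc (m ℕ.+ p))) k ℤ.* binom m k

  -- V p N k is the coefficient of zᴺ aᵏ in vᵖ, where v = 1 + v (a + z (v − 1)) is the
  -- generating function of Dyck paths, a marking the peaks and z the other up steps.
  V : ℕ → ℕ → ℕ → ℤ
  V zero    zero    zero    = + 1
  V zero    zero    (suc k) = + 0
  V zero    (suc N) k       = + 0
  V (suc p) zero    k       = binom (k ℕ.+ p) k
  V (suc p) (suc N) k       = ballot p (N ℕ.+ k) k

  -- With at least one peak, N - 1 + (k + 1) is a natural number even for N = 0, so the two clauses
  -- of `V` merge into one formula.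
  V-ballot : ∀ p N k → V (suc p) N (suc k) ≡ ballot p (N ℕ.+ k) (suc k)
  V-ballot p zero k
    rewrite binom-above k | binom-diag (suc k)
          | ℤ.*-zeroʳ (binom (suc (suc (k ℕ.+ p))) (suc k))
    = sym (trans (ℤ.+-identityʳ _) (ℤ.*-identityʳ _))
  V-ballot p (suc N) k rewrite ℕ.+-suc N k = refl

  V-suc-zero : ∀ p N → V p (suc N) 0 ≡ + 0
  V-suc-zero zero    N = refl
  V-suc-zero (suc p) N
    rewrite binom-zero (suc (N ℕ.+ 0 ℕ.+ p)) | binom-zero (suc (N ℕ.+ 0))
          | binom-zero (suc (suc (N ℕ.+ 0 ℕ.+ p))) | binom-zero (N ℕ.+ 0) = refl

  V-zero-zero : ∀ p → V p 0 0 ≡ + 1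
  V-zero-zero zero    = refl
  V-zero-zero (suc p) = binom-zero p

  -- ballot⁻ (suc p) is ballot p, and ballot⁻ 0 = 0 accounts for v⁰ = 1.
  ballot⁻ : ℕ → ℕ → ℕ → ℤ
  ballot⁻ p m k = binom (m ℕ.+ p) k ℤ.* binom (suc m) k
            ℤ.- binom (suc (m ℕ.+ p)) k ℤ.* binom m k

  V-ballot⁻ : ∀ p N k → V p (suc N) (suc k) ≡ ballot⁻ p (suc (N ℕ.+ k)) (suc k)
  V-ballot⁻ zero N k rewrite ℕ.+-identityʳ (N ℕ.+ k) =
    solve 2 (λ a b → con (+ 0) := a :* b :- b :* a) refl
      (binom (suc (N ℕ.+ k)) (suc k)) (binom (suc (suc (N ℕ.+ k))) (suc k))
    where open +-*-Solver
  V-ballot⁻ (suc p) N k rewrite ℕ.+-suc N k | ℕ.+-suc (N ℕ.+ k) p = refl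

  -- The generic case of `V-rec`. Once Pascal's rule has reduced everything to six binomials, it is
  -- a polynomial identity between them.
  ballot-pascal : ∀ p m k →
    ballot p (suc m) (suc k) ℤ.+ ballot p m (suc k)
      ≡ ballot⁻ p (suc m) (suc k) ℤ.+ ballot p m k ℤ.+ ballot (suc p) m (suc k)
  ballot-pascal p m k
    rewrite ℕ.+-suc m p
          | pascal (suc (suc (m ℕ.+ p))) k | pascal (suc (m ℕ.+ p)) k
          | pascal (suc m) k | pascal m k
    = solve 6 (λ x x₁ x₂ a a₀ a₁ →
        ((x₁ :+ x) :* (a₁ :+ (a₀ :+ a)) :- (x₂ :+ (x₁ :+ x)) :* (a₀ :+ a))
          :+ (x :* (a₀ :+ a) :- (x₁ :+ x) :* a)
        := (x :* (a₁ :+ (a₀ :+ a)) :- (x₁ :+ x) :* (a₀ :+ a))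
          :+ (x₁ :* a₁ :- x₂ :* a₀)
          :+ ((x₁ :+ x) :* (a₀ :+ a) :- (x₂ :+ (x₁ :+ x)) :* a))
        refl (binom (suc (m ℕ.+ p)) (suc k)) (binom (suc (m ℕ.+ p)) k) (binom (suc (suc (m ℕ.+ p))) k)
             (binom m (suc k)) (binom m k) (binom (suc m) k)
    where open +-*-Solver

  shiftℤ : (ℕ → ℤ) → ℕ → ℤ
  shiftℤ f zero    = + 0
  shiftℤ f (suc n) = f n

  -- The equation v = 1 + v (a + z (v - 1)) multiplied by vᵖ, read off at zᴺ aᵏ, with z v moved to
  -- the left to avoid a subtraction.
  V-rec : ∀ p N k →
    V (suc p) N k ℤ.+ shiftℤ (λ N → V (suc p) N k) N
      ≡ V p N k ℤ.+ shiftℤ (V (suc p) N) k ℤ.+ shiftℤ (λ N → V (suc (suc p)) N k) N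
  V-rec p zero zero rewrite V-zero-zero p | binom-zero p = refl
  V-rec zero zero (suc k)
    rewrite ℕ.+-identityʳ k | binom-diag (suc k) | binom-diag k = refl
  V-rec (suc p) zero (suc k)
    rewrite ℕ.+-suc k p | pascal (suc (k ℕ.+ p)) k
    = solve 2 (λ a b → a :+ b :+ con (+ 0) := b :+ a :+ con (+ 0)) refl
        (binom (suc (k ℕ.+ p)) k) (binom (suc (k ℕ.+ p)) (suc k))
    where open +-*-Solver
  V-rec p (suc zero) zero
    rewrite V-suc-zero p 0 | V-suc-zero (suc p) 0 | binom-zero p | binom-zero (suc p) = refl
  V-rec p (suc (suc N)) zero
    rewrite V-suc-zero p (suc N) | V-suc-zero (suc p) (suc N)
          | V-suc-zero (suc p) N | V-suc-zero (suc (suc p)) N = refl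
  V-rec p (suc N) (suc k)
    rewrite V-ballot p N k | V-ballot (suc p) N k | V-ballot⁻ p N k | ℕ.+-suc N k
    = ballot-pascal p (N ℕ.+ k) k

  -- The index `d` stays an integer because it can be -1, where the convention for negative upper
  -- entries decides the value.
  B-evaluate : ∀ N K i j a b c d k →
    N ℤ.+ j ℤ.- + 1 ≡ + a → N ℤ.- i ℤ.- + 1 ≡ + b → N ℤ.+ j ≡ + c → N ℤ.- i ℤ.- + 2 ≡ d →
    K ℤ.- + 1 ≡ + k →
    B N K i j ≡ binom a k ℤ.* binom b k ℤ.- binom c k ℤ.* binomℤ d (+ k)
  B-evaluate N K i j a b c d k e₁ e₂ e₃ e₄ e₅ = trans (args e₁ e₂ e₃ e₄ e₅)
    (cong₂ ℤ._-_ (cong₂ ℤ._*_ (binom-def a k) (binom-def b k))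
                 (cong (ℤ._* binomℤ d (+ k)) (binom-def c k)))
    where
    args : ∀ {x x′ y y′ z z′ w w′ u u′} → x ≡ x′ → y ≡ y′ → z ≡ z′ → w ≡ w′ → u ≡ u′ →
      binomℤ x u ℤ.* binomℤ y u ℤ.- binomℤ z u ℤ.* binomℤ w u
        ≡ binomℤ x′ u′ ℤ.* binomℤ y′ u′ ℤ.- binomℤ z′ u′ ℤ.* binomℤ w′ u′
    args refl refl refl refl refl = refl

  -- For n = N + k + i the index j enters only through the exponent i + j + 1 of v, and what i takes
  -- away from n lowers the degree in z.
  B≡V : ∀ N k i j → B (+ (N ℕ.+ k ℕ.+ i ℕ.+ 1)) (+ (k ℕ.+ 1)) (+ i) (+ j) ≡ V (suc (i ℕ.+ j)) N k
  B≡V N k i j = trans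
    (B-evaluate (+ (N ℕ.+ k ℕ.+ i ℕ.+ 1)) (+ (k ℕ.+ 1)) (+ i) (+ j)
      (N ℕ.+ k ℕ.+ (i ℕ.+ j)) (N ℕ.+ k) (suc (N ℕ.+ k ℕ.+ (i ℕ.+ j))) (+ (N ℕ.+ k) ℤ.- + 1) k
      (solve 3 (λ m i j → m :+ i :+ con (+ 1) :+ j :- con (+ 1) := m :+ (i :+ j)) refl (+ (N ℕ.+ k)) (+ i) (+ j))
      (solve 2 (λ m i → m :+ i :+ con (+ 1) :- i :- con (+ 1) := m) refl (+ (N ℕ.+ k)) (+ i))
      (solve 3 (λ m i j → m :+ i :+ con (+ 1) :+ j := con (+ 1) :+ (m :+ (i :+ j))) refl (+ (N ℕ.+ k)) (+ i) (+ j))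
      (solve 2 (λ m i → m :+ i :+ con (+ 1) :- i :- con (+ 2) := m :- con (+ 1)) refl (+ (N ℕ.+ k)) (+ i))
      (solve 1 (λ k → k :+ con (+ 1) :- con (+ 1) := k) refl (+ k)))
    (cases N k (i ℕ.+ j))
    where
    open +-*-Solver
    cases : ∀ N k p → binom (N ℕ.+ k ℕ.+ p) k ℤ.* binom (N ℕ.+ k) k
      ℤ.- binom (suc (N ℕ.+ k ℕ.+ p)) k ℤ.* binomℤ (+ (N ℕ.+ k) ℤ.- + 1) (+ k) ≡ V (suc p) N k
    -- The only case with upper entry -1: the binomial of -1 over 0 is 0, so the second product
    -- disappears.
    cases zero zero p rewrite binom-zero 0 =
      solve 2 (λ a b → a :* con (+ 1) :- b :* con (+ 0) := a) refl (binom p 0) (binom (suc p) 0)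
    cases zero (suc k) p = trans (cong (λ x → binom (suc (k ℕ.+ p)) (suc k) ℤ.* binom (suc k) (suc k)
        ℤ.- binom (suc (suc k ℕ.+ p)) (suc k) ℤ.* x) (binom-def k (suc k)))
      (sym (V-ballot p 0 k))
    cases (suc N) k p = cong (λ x → binom (suc (N ℕ.+ k ℕ.+ p)) k ℤ.* binom (suc (N ℕ.+ k)) k
        ℤ.- binom (suc (suc N ℕ.+ k ℕ.+ p)) k ℤ.* x) (binom-def (N ℕ.+ k) k)

open Ballots

-- A vector of Booleans records which letters have been used; its head stands for the largest letter.
-- above counts the used letters larger than x, and cost only those that are smaller than some free letter.
above : ∀ {m} → Vec Bool m → Fin m → ℕ
above (b     ∷ P) zero    = 0
above (true  ∷ P) (suc x) = suc (above P x)
above (false ∷ P) (suc x) = above P x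

cost : ∀ {m} → Vec Bool m → Fin m → ℕ
cost (b     ∷ P) zero    = 0
cost (true  ∷ P) (suc x) = cost P x
cost (false ∷ P) (suc x) = above P x

-- No letter above `x` is free; a free `x` read next is then a right-to-left maximum.
isTop : ∀ {m} → Vec Bool m → Fin m → Bool
isTop (b     ∷ P) zero    = true
isTop (true  ∷ P) (suc x) = isTop P x
isTop (false ∷ P) (suc x) = false

patterns : (m r : ℕ) → List (Vec Bool m)
patterns zero    zero    = [] ∷ []
patterns zero    (suc r) = []
patterns (suc m) zero    = map (true ∷_) (patterns m zero)
patterns (suc m) (suc r) = map (true ∷_) (patterns m (suc r)) ++ map (false ∷_) (patterns m r)

patterns-empty : ∀ {m r} → m < r → patterns m r ≡ []
patterns-empty {zero}  {suc r} _         = ≡.refl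
patterns-empty {suc m} {suc r} (s≤s m<r)
  rewrite patterns-empty m<r | patterns-empty (ℕ.m<n⇒m<1+n m<r) = ≡.refl

-- The permutation statistics expressed through the patterns of used letters.

module Statistics where

  open ≡ using (_≢_; refl; sym; trans; cong; cong₂; subst; subst₂; module ≡-Reasoning)

  sumF : ∀ {n} → (Fin n → ℕ) → ℕ
  sumF {zero}  f = 0
  sumF {suc n} f = f zero ℕ.+ sumF (f ∘ suc)

  sumF-cong : ∀ {n} {f g : Fin n → ℕ} → (∀ i → f i ≡ g i) → sumF f ≡ sumF g
  sumF-cong {zero}  e = refl
  sumF-cong {suc n} e = cong₂ ℕ._+_ (e zero) (sumF-cong (e ∘ suc))

  sumF-zero : ∀ n → sumF {n} (λ _ → 0) ≡ 0
  sumF-zero zero    = refl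
  sumF-zero (suc n) = sumF-zero n

  +-interchange : ∀ a b c d → a ℕ.+ b ℕ.+ (c ℕ.+ d) ≡ a ℕ.+ c ℕ.+ (b ℕ.+ d)
  +-interchange a b c d = trans (ℕ.+-assoc a b (c ℕ.+ d))
    (trans (cong (a ℕ.+_) (trans (sym (ℕ.+-assoc b c d)) (trans (cong (ℕ._+ d) (ℕ.+-comm b c)) (ℕ.+-assoc c b d))))
      (sym (ℕ.+-assoc a c (b ℕ.+ d))))

  sumF-+ : ∀ {n} (f g : Fin n → ℕ) → sumF (λ i → f i ℕ.+ g i) ≡ sumF f ℕ.+ sumF g
  sumF-+ {zero}  f g = refl
  sumF-+ {suc n} f g = trans (cong (f zero ℕ.+ g zero ℕ.+_) (sumF-+ (f ∘ suc) (g ∘ suc)))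
    (+-interchange (f zero) (g zero) _ _)

  indicator : Bool → ℕ
  indicator true  = 1
  indicator false = 0

  count : ∀ {n} → (Fin n → Bool) → ℕ
  count f = sumF (indicator ∘ f)

  count-cong : ∀ {n} {f g : Fin n → Bool} → (∀ i → f i ≡ g i) → count f ≡ count g
  count-cong e = sumF-cong (cong indicator ∘ e)

  length-filter-tabulate : ∀ {A : Set} {Q : Pred A 0ℓ} (Q? : Decidable Q) {n} (f : Fin n → A) →
    length (filter Q? (tabulate f)) ≡ count (does ∘ Q? ∘ f)
  length-filter-tabulate Q? {zero}  f = refl
  length-filter-tabulate Q? {suc n} f with does (Q? (f zero))
  ... | true  = cong suc (length-filter-tabulate Q? (f ∘ suc))
  ... | false = length-filter-tabulate Q? (f ∘ suc)

  length-filter-map : ∀ {A B : Set} {Q : Pred B 0ℓ} (Q? : Decidable Q) (f : A → B) xs →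
    length (filter Q? (L.map f xs)) ≡ length (filter (Q? ∘ f) xs)
  length-filter-map Q? f []       = refl
  length-filter-map Q? f (x ∷ xs) with does (Q? (f x))
  ... | true  = cong suc (length-filter-map Q? f xs)
  ... | false = length-filter-map Q? f xs

  length-filter-× : ∀ {A B : Set} {Q : Pred (A × B) 0ℓ} (Q? : Decidable Q) {n} (f : Fin n → A) {m} (g : Fin m → B) →
    length (filter Q? (cartesianProduct (tabulate f) (tabulate g)))
      ≡ sumF (λ i → count (λ j → does (Q? (f i , g j))))
  length-filter-× Q? {zero}  f g = refl
  length-filter-× Q? {suc n} f g = begin
    length (filter Q? (L.map (f zero ,_) ys ++ rest))
      ≡⟨ cong length (L.filter-++ Q? (L.map (f zero ,_) ys) rest) ⟩
    length (filter Q? (L.map (f zero ,_) ys) ++ filter Q? rest)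
      ≡⟨ L.length-++ (filter Q? (L.map (f zero ,_) ys)) ⟩
    length (filter Q? (L.map (f zero ,_) ys)) ℕ.+ length (filter Q? rest)
      ≡⟨ cong₂ ℕ._+_ (trans (length-filter-map Q? (f zero ,_) ys) (length-filter-tabulate (Q? ∘ (f zero ,_)) g))
                   (length-filter-× Q? (f ∘ suc) g) ⟩
    _ ∎
    where
    open ≡-Reasoning
    ys = tabulate g
    rest = cartesianProduct (tabulate (f ∘ suc)) ys

  freeCount : ∀ {m} → Vec Bool m → ℕ
  freeCount []          = 0
  freeCount (true  ∷ P) = freeCount P
  freeCount (false ∷ P) = suc (freeCount P)

  freeCount-update : ∀ {m} (P : Vec Bool m) x → lookup P x ≡ false →
    freeCount P ≡ suc (freeCount (P [ x ]≔ true))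
  freeCount-update (false ∷ P) zero    e = refl
  freeCount-update (true  ∷ P) (suc x) e = freeCount-update P x e
  freeCount-update (false ∷ P) (suc x) e = cong suc (freeCount-update P x e)

  freeCount-replicate : ∀ n → freeCount (replicate n false) ≡ n
  freeCount-replicate zero    = refl
  freeCount-replicate (suc n) = cong suc (freeCount-replicate n)

  lookup-update-other : ∀ {m} (P : Vec Bool m) {x y} → y ≢ x → lookup (P [ x ]≔ true) y ≡ lookup P y
  lookup-update-other P y≢x = Vec.lookup∘update′ y≢x P true

  free-update⁻ : ∀ {m} (P : Vec Bool m) x y → lookup (P [ x ]≔ true) y ≡ false → y ≢ x × lookup P y ≡ false
  free-update⁻ P x y e with y Fin.≟ x
  ... | yes refl = contradiction (trans (sym (Vec.lookup∘update x P true)) e) λ ()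
  ... | no  y≢x  = y≢x , trans (sym (lookup-update-other P y≢x)) e

  sumF-update : ∀ {m} (P : Vec Bool m) x (f : Fin m → ℕ) → lookup P x ≡ false →
    sumF (λ u → if lookup (P [ x ]≔ true) u then f u else 0)
      ≡ sumF (λ u → if lookup P u then f u else 0) ℕ.+ f x
  sumF-update (false ∷ P) zero    f e = ℕ.+-comm (f zero) _
  sumF-update (b ∷ P)     (suc x) f e =
    trans (cong ((if b then f zero else 0) ℕ.+_) (sumF-update P x (f ∘ suc) e))
      (sym (ℕ.+-assoc (if b then f zero else 0) _ _))

  valid : ∀ {m l} → Vec Bool m → Vec (Fin m) l → Bool
  valid P []      = true
  valid P (x ∷ w) = not (lookup P x) ∧ valid (P [ x ]≔ true) w

  valid-∷ : ∀ {m l} (P : Vec Bool m) x (w : Vec (Fin m) l) → valid P (x ∷ w) ≡ true →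
    lookup P x ≡ false × valid (P [ x ]≔ true) w ≡ true
  valid-∷ P x w v with lookup P x
  ... | false = refl , v

  valid-free : ∀ {m l} (P : Vec Bool m) (w : Vec (Fin m) l) → valid P w ≡ true →
    ∀ j → lookup P (lookup w j) ≡ false
  valid-free P (x ∷ w) v zero    = proj₁ (valid-∷ P x w v)
  valid-free P (x ∷ w) v (suc j) =
    proj₂ (free-update⁻ P x (lookup w j) (valid-free (P [ x ]≔ true) w (proj₂ (valid-∷ P x w v)) j))

  -- Each letter lowers `freeCount` by one, so nothing is free at the end. Thus the letters still to
  -- come are exactly the free ones, and the pattern alone tells what the statistics need to know
  -- about the rest of the word.
  valid-exhausts : ∀ {m l} (P : Vec Bool m) (w : Vec (Fin m) l) → valid P w ≡ true → freeCount P ≡ l →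
    ∀ y → lookup P y ≡ false → ∃ λ j → lookup w j ≡ y
  valid-exhausts P []      v e y free = contradiction (trans (sym (freeCount-update P y free)) e) λ ()
  valid-exhausts P (x ∷ w) v e y free with valid-∷ P x w v | y Fin.≟ x
  ... | _       | yes y≡x = zero , sym y≡x
  ... | px , v′ | no  y≢x with valid-exhausts (P [ x ]≔ true) w v′
                                 (ℕ.suc-injective (trans (sym (freeCount-update P x px)) e))
                                 y (trans (lookup-update-other P y≢x) free)
  ...   | j , eq = suc j , eq

  IsInj : ∀ {m l} → Vec (Fin m) l → Set
  IsInj w = ∀ i j → lookup w i ≡ lookup w j → i ≡ j

  valid-injective : ∀ {m l} (P : Vec Bool m) (w : Vec (Fin m) l) → valid P w ≡ true → IsInj w
  valid-injective P (x ∷ w) v zero    zero    e = refl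
  valid-injective P (x ∷ w) v zero    (suc j) e =
    contradiction (sym e) (proj₁ (free-update⁻ P x (lookup w j) (valid-free _ w (proj₂ (valid-∷ P x w v)) j)))
  valid-injective P (x ∷ w) v (suc i) zero    e =
    contradiction e (proj₁ (free-update⁻ P x (lookup w i) (valid-free _ w (proj₂ (valid-∷ P x w v)) i)))
  valid-injective P (x ∷ w) v (suc i) (suc j) e =
    cong suc (valid-injective _ w (proj₂ (valid-∷ P x w v)) i j e)

  injective-valid : ∀ {m l} (P : Vec Bool m) (w : Vec (Fin m) l) → IsInj w →
    (∀ j → lookup P (lookup w j) ≡ false) → valid P w ≡ true
  injective-valid P []      inj free = refl
  injective-valid P (x ∷ w) inj free rewrite free zero =
    injective-valid (P [ x ]≔ true) w (λ i j e → Fin.suc-injective (inj (suc i) (suc j) e))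
      λ j → trans (lookup-update-other P (λ e → contradiction (inj (suc j) zero e) λ ())) (free (suc j))

  isTop-true : ∀ {m} (P : Vec Bool m) x → isTop P x ≡ true → ∀ y → y Fin.< x → lookup P y ≡ true
  isTop-true (true ∷ P) (suc x) t zero    y<x = refl
  isTop-true (true ∷ P) (suc x) t (suc y) y<x = isTop-true P x t y (s<s⁻¹ y<x)

  isTop-false : ∀ {m} (P : Vec Bool m) x → isTop P x ≡ false → ∃ λ y → y Fin.< x × lookup P y ≡ false
  isTop-false (true ∷ P)  (suc x) t with isTop-false P x t
  ... | y , y<x , e = suc y , s<s y<x , e
  isTop-false (false ∷ P) (suc x) t = zero , z<s , refl

  above-count : ∀ {m} (P : Vec Bool m) x → above P x ≡ count (λ u → does (u <? x) ∧ lookup P u)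
  above-count {suc m} (b ∷ P) zero = sym (sumF-zero m)
  above-count (true  ∷ P) (suc x) = cong suc (above-count P x)
  above-count (false ∷ P) (suc x) = above-count P x

  ∧-true : ∀ b → b ∧ true ≡ b
  ∧-true true  = refl
  ∧-true false = refl

  -- Below a free letter `isTop` is always false, so from there on the extra condition holds by
  -- itself and every larger used letter counts.
  cost-count : ∀ {m} (P : Vec Bool m) x →
    cost P x ≡ count (λ u → does (u <? x) ∧ lookup P u ∧ not (isTop P u))
  cost-count {suc m} (b ∷ P) zero = sym (sumF-zero m)
  cost-count (true  ∷ P) (suc x) = cost-count P x
  cost-count (false ∷ P) (suc x) = trans (above-count P x)
    (count-cong λ u → cong (does (u <? x) ∧_) (sym (∧-true (lookup P u))))

  -- The statistics of a word whose letters have been complemented.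
  rlm? : ∀ {m l} (w : Vec (Fin m) l) (i : Fin l) → Dec (∀ j → i Fin.< j → lookup w i Fin.< lookup w j)
  rlm? w i = all? λ j → (i <? j) →-dec (lookup w i <? lookup w j)

  later? : ∀ {m l} (u : Fin m) (w : Vec (Fin m) l) (j : Fin l) → Dec (∃ λ k → j Fin.< k × lookup w k Fin.< u)
  later? u w j = any? λ k → (j <? k) ×-dec (lookup w k <? u)

  -- Position `j` completes a special inversion whose larger letter is `u`. Only the value of `u`
  -- occurs, so that letters read before the start of `w` can take part.
  hit : ∀ {m l} → Fin m → Vec (Fin m) l → Fin l → Bool
  hit u w j = does (u <? lookup w j) ∧ does (later? u w j)

  special : ∀ {m l} → Vec (Fin m) l → Fin l → Fin l → Bool
  special w i j = does (i <? j) ∧ hit (lookup w i) w j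

  specials : ∀ {m l} → Vec (Fin m) l → ℕ
  specials w = sumF (λ i → count (special w i))

  recordsFrom : ∀ {m l} → Vec Bool m → Vec (Fin m) l → ℕ
  recordsFrom P []      = 0
  recordsFrom P (x ∷ w) = indicator (isTop P x) ℕ.+ recordsFrom (P [ x ]≔ true) w

  costsFrom : ∀ {m l} → Vec Bool m → Vec (Fin m) l → ℕ
  costsFrom P []      = 0
  costsFrom P (x ∷ w) = cost P x ℕ.+ costsFrom (P [ x ]≔ true) w

  rlm-suc : ∀ {m l} x (w : Vec (Fin m) l) i → does (rlm? (x ∷ w) (suc i)) ≡ does (rlm? w i)
  rlm-suc x w i = does-⇔ (mk⇔ (λ r j i<j → r (suc j) (s<s i<j))
    (λ { r (suc j) i<j → r j (s<s⁻¹ i<j) })) (rlm? (x ∷ w) (suc i)) (rlm? w i)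

  module _ {m l} (P : Vec Bool m) (x : Fin m) (w : Vec (Fin m) l)
    (v : valid P (x ∷ w) ≡ true) (e : freeCount P ≡ suc l) where

    private
      P′ = P [ x ]≔ true
      px = proj₁ (valid-∷ P x w v)
      v′ = proj₂ (valid-∷ P x w v)
      exhausts : ∀ y → lookup P′ y ≡ false → ∃ λ j → lookup w j ≡ y
      exhausts = valid-exhausts P′ w v′ (ℕ.suc-injective (trans (sym (freeCount-update P x px)) e))
      letter : ∀ j → lookup w j ≢ x × lookup P (lookup w j) ≡ false
      letter j = free-update⁻ P x (lookup w j) (valid-free P′ w v′ j)

    -- The letters of `w` are the free letters other than `x`, so `x` exceeds them all exactly when
    -- nothing above it is free.
    rlm-zero : does (rlm? (x ∷ w) zero) ≡ isTop P x
    rlm-zero with isTop P x in t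
    ... | true  = dec-true (rlm? (x ∷ w) zero) λ { (suc j) _ → larger j }
      where
      larger : ∀ j → x Fin.< lookup w j
      larger j with Fin.<-cmp x (lookup w j)
      ... | tri< x<y _ _ = x<y
      ... | tri≈ _ x≡y _ = contradiction (sym x≡y) (proj₁ (letter j))
      ... | tri> _ _ y<x = contradiction (trans (sym (isTop-true P x t _ y<x)) (proj₂ (letter j))) λ ()
    ... | false with isTop-false P x t
    ...   | y , y<x , free with exhausts y (trans (lookup-update-other P (Fin.<⇒≢ y<x)) free)
    ...     | j , refl = dec-false (rlm? (x ∷ w) zero) λ r → Fin.<-asym y<x (r (suc j) z<s)

    private
      -- A free letter above `u` still occurs in `w`: it differs from `x`, because `u` itself lies
      -- above `x`.
      used-hit : ∀ u → (if lookup P u then indicator (does (u <? x) ∧ does (any? λ j → lookup w j <? u)) else 0)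
        ≡ indicator (does (u <? x) ∧ lookup P u ∧ not (isTop P u))
      -- The Boolean to which `does (u <? x)` reduces is abstracted directly.
      used-hit u with lookup P u | toℕ u ℕ.<ᵇ toℕ x in lt
      ... | true  | false = refl
      ... | false | false = refl
      ... | false | true  = refl
      ... | true  | true  = cong indicator ex
        where
        u<x : u Fin.< x
        u<x = ℕ.<ᵇ⇒< (toℕ u) (toℕ x) (subst T (sym lt) tt)
        ex : does (any? λ j → lookup w j <? u) ≡ not (isTop P u)
        ex with isTop P u in t
        ... | true  = dec-false (any? λ j → lookup w j <? u) λ (j , y<u) →
                        contradiction (trans (sym (isTop-true P u t _ y<u)) (proj₂ (letter j))) λ ()
        ... | false with isTop-false P u t
        ...   | y , y<u , free with exhausts y (trans (lookup-update-other P (Fin.<⇒≢ (Fin.<-trans y<u u<x))) free)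
        ...     | j , refl = dec-true (any? λ j → lookup w j <? u) (j , y<u)

    cost-used : sumF (λ u → if lookup P u then indicator (does (u <? x) ∧ does (any? λ j → lookup w j <? u)) else 0)
      ≡ cost P x
    cost-used = trans (sumF-cong used-hit) (sym (cost-count P x))

  count-rlm : ∀ {m l} (P : Vec Bool m) (w : Vec (Fin m) l) → valid P w ≡ true → freeCount P ≡ l →
    count (λ i → does (rlm? w i)) ≡ recordsFrom P w
  count-rlm P []      v e = refl
  count-rlm P (x ∷ w) v e = cong₂ ℕ._+_ (cong indicator (rlm-zero P x w v e))
    (trans (count-cong (rlm-suc x w)) (count-rlm (P [ x ]≔ true) w (proj₂ (valid-∷ P x w v))
      (ℕ.suc-injective (trans (sym (freeCount-update P x (proj₁ (valid-∷ P x w v)))) e))))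

  hit-zero : ∀ {m l} u x (w : Vec (Fin m) l) →
    hit u (x ∷ w) zero ≡ does (u <? x) ∧ does (any? λ j → lookup w j <? u)
  hit-zero u x w = cong (does (u <? x) ∧_) (does-⇔
    (mk⇔ (λ { (suc k , _ , y<u) → k , y<u }) (λ (k , y<u) → suc k , z<s , y<u))
    (later? u (x ∷ w) zero) (any? λ j → lookup w j <? u))

  hit-suc : ∀ {m l} u x (w : Vec (Fin m) l) j → hit u (x ∷ w) (suc j) ≡ hit u w j
  hit-suc u x w j = cong (does (u <? lookup w j) ∧_) (does-⇔
    (mk⇔ (λ { (suc k , j<k , y<u) → k , s<s⁻¹ j<k , y<u }) (λ (k , j<k , y<u) → suc k , s<s j<k , y<u))
    (later? u (x ∷ w) (suc j)) (later? u w j))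

  specials-∷ : ∀ {m l} x (w : Vec (Fin m) l) → specials (x ∷ w) ≡ count (hit x w) ℕ.+ specials w
  specials-∷ x w = cong₂ ℕ._+_ (count-cong (hit-suc x x w))
    (sumF-cong λ i → count-cong λ j → cong (does (i <? j) ∧_) (hit-suc (lookup w i) x w j))

  -- A special inversion is charged to its smaller letter once the larger one has been used.
  specials-costs : ∀ {m l} (P : Vec Bool m) (w : Vec (Fin m) l) → valid P w ≡ true → freeCount P ≡ l →
    sumF (λ u → if lookup P u then count (hit u w) else 0) ℕ.+ specials w ≡ costsFrom P w
  specials-costs {m} P [] v e =
    trans (ℕ.+-identityʳ _) (trans (sumF-cong λ u → if-same (lookup P u)) (sumF-zero m))
    where
    if-same : ∀ b → (if b then 0 else 0) ≡ 0
    if-same true  = refl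
    if-same false = refl
  specials-costs P (x ∷ w) v e = begin
    sumF (λ u → if lookup P u then count (hit u (x ∷ w)) else 0) ℕ.+ specials (x ∷ w)
      ≡⟨ cong₂ ℕ._+_ (sumF-cong split) (specials-∷ x w) ⟩
    sumF (λ u → first u ℕ.+ others u) ℕ.+ (count (hit x w) ℕ.+ specials w)
      ≡⟨ cong (ℕ._+ (count (hit x w) ℕ.+ specials w)) (sumF-+ first others) ⟩
    sumF first ℕ.+ sumF others ℕ.+ (count (hit x w) ℕ.+ specials w)
      ≡⟨ trans (ℕ.+-assoc (sumF first) _ _) (cong (sumF first ℕ.+_) (sym (ℕ.+-assoc (sumF others) _ _))) ⟩
    sumF first ℕ.+ (sumF others ℕ.+ count (hit x w) ℕ.+ specials w)
      -- Now `x` joins the used letters: its own hits in `w` become one more term of the sum over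
      -- them.
      ≡⟨ cong (λ s → sumF first ℕ.+ (s ℕ.+ specials w)) (sumF-update P x (λ u → count (hit u w)) px) ⟨
    sumF first ℕ.+ (sumF (λ u → if lookup (P [ x ]≔ true) u then count (hit u w) else 0) ℕ.+ specials w)
      ≡⟨ cong₂ ℕ._+_ (cost-used P x w v e)
           (specials-costs (P [ x ]≔ true) w v′ (ℕ.suc-injective (trans (sym (freeCount-update P x px)) e))) ⟩
    costsFrom P (x ∷ w) ∎
    where
    open ≡-Reasoning
    px = proj₁ (valid-∷ P x w v)
    v′ = proj₂ (valid-∷ P x w v)
    first others : _ → ℕ
    first u  = if lookup P u then indicator (does (u <? x) ∧ does (any? λ j → lookup w j <? u)) else 0
    others u = if lookup P u then count (hit u w) else 0
    split : ∀ u → (if lookup P u then count (hit u (x ∷ w)) else 0) ≡ first u ℕ.+ others u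
    split u with lookup P u
    ... | true  = cong₂ ℕ._+_ (cong indicator (hit-zero u x w)) (count-cong (hit-suc u x w))
    ... | false = refl

  opposite-< : ∀ {n} {i j : Fin n} → i Fin.< j → opposite j Fin.< opposite i
  opposite-< {n} {i} {j} i<j rewrite Fin.opposite-prop i | Fin.opposite-prop j =
    ℕ.∸-monoʳ-< (s<s i<j) (Fin.toℕ<n j)

  opposite-<⁻ : ∀ {n} {i j : Fin n} → opposite i Fin.< opposite j → j Fin.< i
  opposite-<⁻ {i = i} {j} o = subst₂ Fin._<_ (Fin.opposite-involutive j) (Fin.opposite-involutive i) (opposite-< o)

  module _ {n} (w : Vec (Fin n) n) where

    private
      σ = Vec.map opposite w
      σ-lookup : ∀ i → lookup σ i ≡ opposite (lookup w i)
      σ-lookup i = Vec.lookup-map i opposite w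
      to : ∀ {i j} → lookup σ i Fin.< lookup σ j → lookup w j Fin.< lookup w i
      to {i} {j} s rewrite σ-lookup i | σ-lookup j = opposite-<⁻ s
      from : ∀ {i j} → lookup w j Fin.< lookup w i → lookup σ i Fin.< lookup σ j
      from {i} {j} s rewrite σ-lookup i | σ-lookup j = opposite-< s

    -- Starting with no used letter, `valid` tests for repetitions, and the involution `opposite`
    -- neither creates nor removes any.
    injective-complement : does (injective? (Vec.map opposite w)) ≡ valid (replicate n false) w
    injective-complement with valid (replicate n false) w in v
    ... | true  = dec-true (injective? σ) λ i j e → valid-injective _ w v i j
                    (subst₂ _≡_ (Fin.opposite-involutive _) (Fin.opposite-involutive _)
                      (cong opposite (trans (sym (σ-lookup i)) (trans e (σ-lookup j)))))
    ... | false = dec-false (injective? σ) λ inj → contradiction (trans (sym v) (injective-valid _ w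
                    (λ i j e → inj i j (trans (σ-lookup i) (trans (cong opposite e) (sym (σ-lookup j)))))
                    λ j → Vec.lookup-replicate (lookup w j) false)) λ ()

    rlm-complement : valid (replicate n false) w ≡ true →
      rlm (Vec.map opposite w) ≡ recordsFrom (replicate n false) w
    rlm-complement v = trans (length-filter-tabulate (isRLM? σ) id)
      (trans (count-cong λ i → does-⇔ (mk⇔ (λ r j i<j → to (r j i<j)) (λ r j i<j → from (r j i<j)))
                (isRLM? σ i) (rlm? w i))
        (count-rlm _ w v (freeCount-replicate n)))

    inv′-complement : valid (replicate n false) w ≡ true →
      inv′ (Vec.map opposite w) ≡ costsFrom (replicate n false) w
    inv′-complement v = begin
      inv′ σ
        ≡⟨ length-filter-× (isSpecialInv? σ) id id ⟩
      sumF (λ i → count (λ j → does (isSpecialInv? σ (i , j))))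
        ≡⟨ sumF-cong (λ i → count-cong λ j → cong (does (i <? j) ∧_) (cong₂ _∧_
             (does-⇔ (mk⇔ to from) (lookup σ j <? lookup σ i) (lookup w i <? lookup w j))
             (does-⇔ (mk⇔ (λ (k , j<k , s) → k , j<k , to s) (λ (k , j<k , s) → k , j<k , from s))
               (any? λ k → (j <? k) ×-dec (lookup σ i <? lookup σ k)) (later? (lookup w i) w j)))) ⟩
      specials w
        ≡⟨ cong (ℕ._+ specials w) (trans (sumF-cong λ u → cong (λ b → if b then count (hit u w) else 0)
             (Vec.lookup-replicate u false)) (sumF-zero n)) ⟨
      sumF (λ u → if lookup (replicate n false) u then count (hit u w) else 0) ℕ.+ specials w
        ≡⟨ specials-costs _ w v (freeCount-replicate n) ⟩
      costsFrom (replicate n false) w ∎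
      where open ≡-Reasoning

open Statistics

-- Finite sums in a commutative ring.

module Sums (R : CommutativeRing 0ℓ 0ℓ) where

  open CommutativeRing R hiding (zero)
  open SetoidReasoning setoid

  ∑ : ∀ {A : Set} → List A → (A → Carrier) → Carrier
  ∑ xs f = foldr _+_ 0# (map f xs)

  module _ {A : Set} where

    ∑-cong : ∀ {f g : A → Carrier} xs → (∀ x → f x ≈ g x) → ∑ xs f ≈ ∑ xs g
    ∑-cong []       e = refl
    ∑-cong (x ∷ xs) e = +-cong (e x) (∑-cong xs e)

    ∑-zero : ∀ (xs : List A) → ∑ xs (λ _ → 0#) ≈ 0#
    ∑-zero []       = refl
    ∑-zero (x ∷ xs) = trans (+-identityˡ _) (∑-zero xs)

    ∑-+ : ∀ (f g : A → Carrier) xs → ∑ xs (λ x → f x + g x) ≈ ∑ xs f + ∑ xs g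
    ∑-+ f g []       = sym (+-identityʳ 0#)
    ∑-+ f g (x ∷ xs) = begin
      f x + g x + ∑ xs (λ x → f x + g x)  ≈⟨ +-congˡ (∑-+ f g xs) ⟩
      f x + g x + (∑ xs f + ∑ xs g)       ≈⟨ +-assoc _ _ _ ⟩
      f x + (g x + (∑ xs f + ∑ xs g))     ≈⟨ +-congˡ (+-assoc _ _ _) ⟨
      f x + (g x + ∑ xs f + ∑ xs g)       ≈⟨ +-congˡ (+-congʳ (+-comm _ _)) ⟩
      f x + (∑ xs f + g x + ∑ xs g)       ≈⟨ +-congˡ (+-assoc _ _ _) ⟩
      f x + (∑ xs f + (g x + ∑ xs g))     ≈⟨ +-assoc _ _ _ ⟨
      f x + ∑ xs f + (g x + ∑ xs g)       ∎

    ∑-* : ∀ c (f : A → Carrier) xs → ∑ xs (λ x → c * f x) ≈ c * ∑ xs f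
    ∑-* c f []       = sym (zeroʳ c)
    ∑-* c f (x ∷ xs) = trans (+-congˡ (∑-* c f xs)) (sym (distribˡ _ _ _))

    ∑-++ : ∀ (f : A → Carrier) xs ys → ∑ (xs ++ ys) f ≈ ∑ xs f + ∑ ys f
    ∑-++ f []       ys = sym (+-identityˡ _)
    ∑-++ f (x ∷ xs) ys = trans (+-congˡ (∑-++ f xs ys)) (sym (+-assoc _ _ _))

  ∑-map : ∀ {A B : Set} (f : B → Carrier) (g : A → B) xs → ∑ (map g xs) f ≡ ∑ xs (f ∘ g)
  ∑-map f g xs = ≡.cong (foldr _+_ 0#) (≡.sym (L.map-∘ xs))

  ∑-swap : ∀ {A B : Set} (f : A → B → Carrier) xs ys →
    ∑ xs (λ x → ∑ ys (f x)) ≈ ∑ ys (λ y → ∑ xs (λ x → f x y))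
  ∑-swap f []       ys = sym (∑-zero ys)
  ∑-swap f (x ∷ xs) ys = trans (+-congˡ (∑-swap f xs ys)) (sym (∑-+ _ _ ys))

  ∑-allFin : ∀ {n} (f : Fin (suc n) → Carrier) →
    ∑ (allFin (suc n)) f ≡ f zero + ∑ (allFin n) (f ∘ suc)
  ∑-allFin f = ≡.cong (λ xs → f zero + foldr _+_ 0# xs)
    (≡.trans (L.map-tabulate suc f) (≡.sym (L.map-tabulate id (f ∘ suc))))

module QSeries (R : CommutativeRing 0ℓ 0ℓ)
  (ℤ⟶R : ℤ.+-*-rawRing -Raw-AlmostCommutative⟶ fromCommutativeRing R)
  (q : CommutativeRing.Carrier R) where

  open CommutativeRing R hiding (zero)
  open Algebra.Properties.Semiring.Exp semiring using (_^_; ^-homo-*)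
  open _-Raw-AlmostCommutative⟶_ ℤ⟶R using (+-homo; -‿homo; 0-homo; 1-homo) renaming (⟦_⟧ to ι)

  ι-≟ : ∀ x y → Maybe (ι x ≈ ι y)
  ι-≟ x y with x ℤ.≟ y
  ... | yes ≡.refl = just refl
  ... | no  _      = nothing

  open Algebra.Solver.Ring ℤ.+-*-rawRing (fromCommutativeRing R) ℤ⟶R ι-≟
    using (solve; _:=_; _:+_; _:*_; _:-_; :-_; con)
  open Sums R
  open SetoidReasoning setoid

  ≡⇒≈ : ∀ {x y} → x ≡ y → x ≈ y
  ≡⇒≈ ≡.refl = refl

  -- q-integers and Gaussian binomials.

  [_] : ℕ → Carrier
  [ zero ]  = 0#
  [ suc n ] = [ n ] + q ^ n

  []-+ : ∀ m n → [ m ℕ.+ n ] ≈ [ m ] + q ^ m * [ n ]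
  []-+ m zero = begin
    [ m ℕ.+ 0 ]         ≡⟨ ≡.cong [_] (ℕ.+-identityʳ m) ⟩
    [ m ]               ≈⟨ +-identityʳ [ m ] ⟨
    [ m ] + 0#          ≈⟨ +-congˡ (zeroʳ (q ^ m)) ⟨
    [ m ] + q ^ m * 0#  ∎
  []-+ m (suc n) = begin
    [ m ℕ.+ suc n ]                        ≡⟨ ≡.cong [_] (ℕ.+-suc m n) ⟩
    [ m ℕ.+ n ] + q ^ (m ℕ.+ n)            ≈⟨ +-cong ([]-+ m n) (^-homo-* q m n) ⟩
    [ m ] + q ^ m * [ n ] + q ^ m * q ^ n  ≈⟨ +-assoc _ _ _ ⟩
    [ m ] + (q ^ m * [ n ] + q ^ m * q ^ n) ≈⟨ +-congˡ (distribˡ _ _ _) ⟨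
    [ m ] + q ^ m * ([ n ] + q ^ n)        ∎

  []-suc : ∀ n → [ suc n ] ≈ 1# + q * [ n ]
  []-suc n = begin
    [ suc n ]                ≈⟨ []-+ 1 n ⟩
    0# + 1# + q * 1# * [ n ] ≈⟨ +-cong (+-identityˡ 1#) (*-congʳ (*-identityʳ q)) ⟩
    1# + q * [ n ]           ∎

  [1-q]*[] : ∀ n → (1# - q) * [ n ] ≈ 1# - q ^ n
  [1-q]*[] zero = begin
    (1# - q) * 0#  ≈⟨ zeroʳ _ ⟩
    0#             ≈⟨ -‿inverseʳ 1# ⟨
    1# - 1#        ∎
  [1-q]*[] (suc n) = begin
    (1# - q) * ([ n ] + q ^ n)
      ≈⟨ distribˡ _ _ _ ⟩
    (1# - q) * [ n ] + (1# - q) * q ^ n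
      ≈⟨ +-congʳ ([1-q]*[] n) ⟩
    (1# - q ^ n) + (1# - q) * q ^ n
      ≈⟨ solve 3 (λ o q x → (o :- x) :+ (o :- q) :* x := o :- q :* x :+ (o :* x :- x)) refl 1# q (q ^ n) ⟩
    1# - q * q ^ n + (1# * q ^ n - q ^ n)
      ≈⟨ +-congˡ (trans (+-congʳ (*-identityˡ _)) (-‿inverseʳ _)) ⟩
    1# - q * q ^ n + 0#
      ≈⟨ +-identityʳ _ ⟩
    1# - q * q ^ n ∎

  -- gauss h i is the q-binomial coefficient of h − 1 + i over i.
  gauss : ℕ → ℕ → Carrier
  gauss zero    zero    = 1#
  gauss zero    (suc i) = 0#
  gauss (suc h) zero    = 1#
  gauss (suc h) (suc i) = gauss h (suc i) + q ^ h * gauss (suc h) i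

  gauss-zeroʳ : ∀ h → gauss h 0 ≡ 1#
  gauss-zeroʳ zero    = ≡.refl
  gauss-zeroʳ (suc h) = ≡.refl

  gauss-absorb-zero : ∀ i → [ i ] * gauss 0 i ≈ 0#
  gauss-absorb-zero zero    = zeroˡ 1#
  gauss-absorb-zero (suc i) = zeroʳ _

  -- The two absorption identities have the same right-hand side. After Pascal's rule, each
  -- therefore allows the other to rewrite one of the two terms as a multiple of the Gaussian
  -- binomial in the remaining term; hence the mutual induction.
  gauss-absorbʳ : ∀ h i → [ suc i ] * gauss h (suc i) ≈ [ h ℕ.+ i ] * gauss h i
  gauss-absorbˡ : ∀ h i → [ h ] * gauss (suc h) i ≈ [ h ℕ.+ i ] * gauss h i

  gauss-absorbʳ zero    i = trans (zeroʳ _) (sym (gauss-absorb-zero i))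
  gauss-absorbʳ (suc h) i = begin
    [ suc i ] * (gauss h (suc i) + q ^ h * gauss (suc h) i)
      ≈⟨ solve 4 (λ a b c d → a :* (b :+ c :* d) := a :* b :+ c :* a :* d) refl
           [ suc i ] (gauss h (suc i)) (q ^ h) (gauss (suc h) i) ⟩
    [ suc i ] * gauss h (suc i) + q ^ h * [ suc i ] * gauss (suc h) i
      ≈⟨ +-congʳ (trans (gauss-absorbʳ h i) (sym (gauss-absorbˡ h i))) ⟩
    [ h ] * gauss (suc h) i + q ^ h * [ suc i ] * gauss (suc h) i
      ≈⟨ distribʳ _ _ _ ⟨
    ([ h ] + q ^ h * [ suc i ]) * gauss (suc h) i
      ≈⟨ *-congʳ (sym (trans (≡⇒≈ (≡.cong [_] (≡.sym (ℕ.+-suc h i)))) ([]-+ h (suc i)))) ⟩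
    [ suc h ℕ.+ i ] * gauss (suc h) i ∎

  gauss-absorbˡ zero    i    = trans (zeroˡ _) (sym (gauss-absorb-zero i))
  gauss-absorbˡ (suc h) zero = *-congʳ (≡⇒≈ (≡.cong [_] (≡.sym (ℕ.+-identityʳ (suc h)))))
  gauss-absorbˡ (suc h) (suc i) = begin
    [ suc h ] * (gauss (suc h) (suc i) + q ^ suc h * gauss (suc (suc h)) i)
      ≈⟨ solve 4 (λ a b c d → a :* (b :+ c :* d) := a :* b :+ c :* (a :* d)) refl
           [ suc h ] (gauss (suc h) (suc i)) (q ^ suc h) (gauss (suc (suc h)) i) ⟩
    [ suc h ] * gauss (suc h) (suc i) + q ^ suc h * ([ suc h ] * gauss (suc (suc h)) i)
      ≈⟨ +-congˡ (*-congˡ (trans (gauss-absorbˡ (suc h) i) (sym (gauss-absorbʳ (suc h) i)))) ⟩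
    [ suc h ] * gauss (suc h) (suc i) + q ^ suc h * ([ suc i ] * gauss (suc h) (suc i))
      ≈⟨ solve 4 (λ a b c d → a :* b :+ c :* (d :* b) := (a :+ c :* d) :* b) refl
           [ suc h ] (gauss (suc h) (suc i)) (q ^ suc h) [ suc i ] ⟩
    ([ suc h ] + q ^ suc h * [ suc i ]) * gauss (suc h) (suc i)
      ≈⟨ *-congʳ ([]-+ (suc h) (suc i)) ⟨
    [ suc h ℕ.+ suc i ] * gauss (suc h) (suc i) ∎

  -- Absorption multiplied by 1 - q, the form in which the factor 1 - qʰ⁺¹ of the recurrence meets
  -- the terms of the series.
  gauss-absorb-powers : ∀ h i → (1# - q ^ h) * gauss (suc h) i ≈ (1# - q ^ h * q ^ i) * gauss h i
  gauss-absorb-powers h i = begin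
    (1# - q ^ h) * gauss (suc h) i           ≈⟨ *-congʳ ([1-q]*[] h) ⟨
    (1# - q) * [ h ] * gauss (suc h) i       ≈⟨ *-assoc _ _ _ ⟩
    (1# - q) * ([ h ] * gauss (suc h) i)     ≈⟨ *-congˡ (gauss-absorbˡ h i) ⟩
    (1# - q) * ([ h ℕ.+ i ] * gauss h i)     ≈⟨ *-assoc _ _ _ ⟨
    (1# - q) * [ h ℕ.+ i ] * gauss h i       ≈⟨ *-congʳ ([1-q]*[] (h ℕ.+ i)) ⟩
    (1# - q ^ (h ℕ.+ i)) * gauss h i         ≈⟨ *-congʳ (+-congˡ (-‿cong (^-homo-* q h i))) ⟩
    (1# - q ^ h * q ^ i) * gauss h i         ∎

  [_]! : ℕ → Carrier
  [ zero ]!  = 1#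
  [ suc n ]! = [ suc n ] * [ n ]!

  gauss-factorials : ∀ h i → [ i ]! * [ h ]! * gauss (suc h) i ≈ [ h ℕ.+ i ]!
  gauss-factorials h zero = begin
    1# * [ h ]! * 1#  ≈⟨ *-identityʳ _ ⟩
    1# * [ h ]!       ≈⟨ *-identityˡ _ ⟩
    [ h ]!            ≡⟨ ≡.cong [_]! (ℕ.+-identityʳ h) ⟨
    [ h ℕ.+ 0 ]!      ∎
  gauss-factorials h (suc i) = begin
    [ suc i ] * [ i ]! * [ h ]! * gauss (suc h) (suc i)
      ≈⟨ solve 4 (λ a b c d → a :* b :* c :* d := b :* c :* (a :* d)) refl
           [ suc i ] [ i ]! [ h ]! (gauss (suc h) (suc i)) ⟩
    [ i ]! * [ h ]! * ([ suc i ] * gauss (suc h) (suc i))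
      ≈⟨ *-congˡ (gauss-absorbʳ (suc h) i) ⟩
    [ i ]! * [ h ]! * ([ suc h ℕ.+ i ] * gauss (suc h) i)
      ≈⟨ solve 4 (λ a b c d → a :* b :* (c :* d) := c :* (a :* b :* d)) refl
           [ i ]! [ h ]! [ suc h ℕ.+ i ] (gauss (suc h) i) ⟩
    [ suc h ℕ.+ i ] * ([ i ]! * [ h ]! * gauss (suc h) i)
      ≈⟨ *-congˡ (gauss-factorials h i) ⟩
    [ suc (h ℕ.+ i) ]!
      ≡⟨ ≡.cong [_]! (ℕ.+-suc h i) ⟨
    [ h ℕ.+ suc i ]! ∎

  -- The explicit series and its recurrence.

  shift : (ℕ → Carrier) → ℕ → Carrier
  shift f zero    = 0#
  shift f (suc n) = f n

  shift-cong : ∀ {f g} → (∀ n → f n ≈ g n) → ∀ n → shift f n ≈ shift g n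
  shift-cong e zero    = refl
  shift-cong e (suc n) = e n

  shift-* : ∀ c f n → shift (λ m → c * f m) n ≈ c * shift f n
  shift-* c f zero    = sym (zeroʳ c)
  shift-* c f (suc n) = refl

  shift-+ : ∀ f g n → shift (λ m → f m + g m) n ≈ shift f n + shift g n
  shift-+ f g zero    = sym (+-identityʳ 0#)
  shift-+ f g (suc n) = refl

  shift-sub : ∀ f c g n → shift (λ m → f m - c * g m) n ≈ shift f n - c * shift g n
  shift-sub f c g zero    = sym (trans (+-cong refl (-‿cong (zeroʳ c))) (-‿inverseʳ 0#))
  shift-sub f c g (suc n) = refl

  ι-shift : ∀ f n → ι (shiftℤ f n) ≈ shift (λ m → ι (f m)) n
  ι-shift f zero    = 0-homo
  ι-shift f (suc n) = refl

  -- The coefficient of zᴺ aᵏ in vᵖ (1 − v) (1 − q v) ⋯ (1 − qⁱ⁻¹ v).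
  X : (i p N k : ℕ) → Carrier
  X zero    p N k = ι (V p N k)
  X (suc i) p N k = X i p N k - q ^ i * X i (suc p) N k

  -- The relation `V-rec` survives multiplication by a polynomial in v. `shift` in `N` is
  -- multiplication by z, and `shift` in `k` is multiplication by a.
  X-rec : ∀ i p N k →
    X i (suc p) N k + shift (λ N → X i (suc p) N k) N
      ≈ X i p N k + shift (X i (suc p) N) k + shift (λ N → X i (suc (suc p)) N k) N
  X-rec zero p N k = begin
    ι (V (suc p) N k) + shift (λ N → ι (V (suc p) N k)) N
      ≈⟨ +-congˡ (ι-shift _ N) ⟨
    ι (V (suc p) N k) + ι (shiftℤ (λ N → V (suc p) N k) N)
      ≈⟨ +-homo _ _ ⟨
    ι (V (suc p) N k ℤ.+ shiftℤ (λ N → V (suc p) N k) N)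
      ≡⟨ ≡.cong ι (V-rec p N k) ⟩
    ι (V p N k ℤ.+ shiftℤ (V (suc p) N) k ℤ.+ shiftℤ (λ N → V (suc (suc p)) N k) N)
      ≈⟨ trans (+-homo _ _) (+-congʳ (+-homo _ _)) ⟩
    ι (V p N k) + ι (shiftℤ (V (suc p) N) k) + ι (shiftℤ (λ N → V (suc (suc p)) N k) N)
      ≈⟨ +-cong (+-congˡ (ι-shift _ k)) (ι-shift _ N) ⟩
    ι (V p N k) + shift (λ k → ι (V (suc p) N k)) k + shift (λ N → ι (V (suc (suc p)) N k)) N ∎
  X-rec (suc i) p N k = begin
    (x₁ - c * x₂) + shift (λ N → X i (suc p) N k - c * X i (suc (suc p)) N k) N
      ≈⟨ +-congˡ (shift-sub _ c _ N) ⟩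
    (x₁ - c * x₂) + (z₁ - c * z₂)
      ≈⟨ solve 5 (λ x₁ x₂ z₁ z₂ c → (x₁ :- c :* x₂) :+ (z₁ :- c :* z₂)
           := (x₁ :+ z₁) :- c :* (x₂ :+ z₂)) refl x₁ x₂ z₁ z₂ c ⟩
    (x₁ + z₁) - c * (x₂ + z₂)
      ≈⟨ +-cong (X-rec i p N k) (-‿cong (*-congˡ (X-rec i (suc p) N k))) ⟩
    (x₀ + a₁ + z₂) - c * (x₁ + a₂ + z₃)
      ≈⟨ solve 7 (λ x₀ x₁ a₁ a₂ z₂ z₃ c → (x₀ :+ a₁ :+ z₂) :- c :* (x₁ :+ a₂ :+ z₃)
           := (x₀ :- c :* x₁) :+ (a₁ :- c :* a₂) :+ (z₂ :- c :* z₃)) refl x₀ x₁ a₁ a₂ z₂ z₃ c ⟩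
    (x₀ - c * x₁) + (a₁ - c * a₂) + (z₂ - c * z₃)
      ≈⟨ +-cong (+-congˡ (shift-sub _ c _ k)) (shift-sub _ c _ N) ⟨
    X (suc i) p N k + shift (X (suc i) (suc p) N) k + shift (λ N → X (suc i) (suc (suc p)) N k) N ∎
    where
    c  = q ^ i
    x₀ = X i p N k
    x₁ = X i (suc p) N k
    x₂ = X i (suc (suc p)) N k
    a₁ = shift (X i (suc p) N) k
    a₂ = shift (X i (suc (suc p)) N) k
    z₁ = shift (λ N → X i (suc p) N k) N
    z₂ = shift (λ N → X i (suc (suc p)) N k) N
    z₃ = shift (λ N → X i (suc (suc (suc p))) N k) N

  -- The factor zⁱ of the series is left out here; `tail` restores it by lowering `N` at each step.
  summand : (h i N k : ℕ) → Carrier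
  summand h i N k = q ^ i * (gauss h i * X i (h ℕ.+ i) N k)

  -- tail h 0 N k is the coefficient of zᴺ aᵏ in the series g_h = ∑ᵢ (q z v)ⁱ gauss h i vʰ (1 − v) ⋯ (1 − qⁱ⁻¹ v).
  tail : (h i N k : ℕ) → Carrier
  tail h i zero    k = summand h i zero k
  tail h i (suc N) k = summand h i (suc N) k + tail h (suc i) N k

  tail-unfold : ∀ h i N k → tail h i N k ≈ summand h i N k + shift (λ N → tail h (suc i) N k) N
  tail-unfold h i zero    k = sym (+-identityʳ _)
  tail-unfold h i (suc N) k = refl

  -- What is left of the telescoping sum in tail-rec when the series is cut off below i.
  boundary : (h i N k : ℕ) → Carrier
  boundary h i N k = (gauss (suc h) i - gauss h i) * (q ^ i * X i (h ℕ.+ i) N k)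

  shift-summand : ∀ h i N k →
    shift (summand h i N) k ≈ q ^ i * (gauss h i * shift (X i (h ℕ.+ i) N) k)
  shift-summand h i N k = trans (shift-* _ _ k) (*-congˡ (shift-* _ _ k))

  -- The recurrence holds for a single term up to the difference of two consecutive boundaries.
  -- Pascal's rule leaves qʰ `c` in the boundary at i + 1, `X (suc i)` splits as x₁ - qⁱ x₂, and
  -- `X-rec` eliminates x₁′.
  summand-rec : ∀ h i N k →
    summand (suc h) i (suc N) k + boundary h (suc i) N k
      ≈ summand h i (suc N) k + shift (summand (suc h) i (suc N)) k
        + (1# - q ^ suc h) * (summand (suc (suc h)) i N k - summand (suc h) i N k)
        + boundary h i (suc N) k
  summand-rec h i N k = begin
    Q * (c * x₁′) + (c₀′ + y * c - c₀′) * (q * Q * X (suc i) (h ℕ.+ suc i) N k)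
      ≈⟨ +-cong (*-congˡ (*-congˡ x₁′≈))
           (*-congˡ (*-congˡ (≡⇒≈ (≡.cong (λ p → X (suc i) p N k) (ℕ.+-suc h i))))) ⟩
    Q * (c * (x₀ + κ + x₂ - x₁)) + (c₀′ + y * c - c₀′) * (q * Q * (x₁ - Q * x₂))
      ≈⟨ solve 10 (λ Q c c₀ c₀′ y q x₀ κ x₁ x₂ →
           Q :* (c :* (x₀ :+ κ :+ x₂ :- x₁)) :+ (c₀′ :+ y :* c :- c₀′) :* (q :* Q :* (x₁ :- Q :* x₂))
           := Q :* (c₀ :* x₀) :+ Q :* (c :* κ)
              :+ ((con (+ 1) :- q :* y :* Q) :* c :* (Q :* x₂) :- (con (+ 1) :- q :* y) :* (Q :* (c :* x₁)))
              :+ (c :- c₀) :* (Q :* x₀))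
           refl Q c c₀ c₀′ y q x₀ κ x₁ x₂ ⟩
    Q * (c₀ * x₀) + Q * (c * κ)
      + ((ι (+ 1) - q * y * Q) * c * (Q * x₂) - (ι (+ 1) - q * y) * (Q * (c * x₁)))
      + (c - c₀) * (Q * x₀)
      -- Absorption trades 1 - qʰ⁺¹⁺ⁱ for the factor 1 - qʰ⁺¹ of the recurrence by raising h in the
      -- Gaussian binomial.
      ≈⟨ +-congʳ (+-congˡ (+-cong (*-congʳ (trans (*-congʳ (+-congʳ 1-homo)) (sym (gauss-absorb-powers (suc h) i))))
           (-‿cong (*-congʳ (+-congʳ 1-homo))))) ⟩
    Q * (c₀ * x₀) + Q * (c * κ)
      + ((1# - q * y) * c₂ * (Q * x₂) - (1# - q * y) * (Q * (c * x₁)))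
      + (c - c₀) * (Q * x₀)
      ≈⟨ +-congʳ (+-congˡ (solve 6 (λ w c₂ Q x₂ c x₁ →
           w :* c₂ :* (Q :* x₂) :- w :* (Q :* (c :* x₁)) := w :* (Q :* (c₂ :* x₂) :- Q :* (c :* x₁)))
           refl (1# - q * y) c₂ Q x₂ c x₁)) ⟩
    Q * (c₀ * x₀) + Q * (c * κ)
      + (1# - q * y) * (Q * (c₂ * x₂) - Q * (c * x₁))
      + (c - c₀) * (Q * x₀)
      ≈⟨ +-congʳ (+-congʳ (+-congˡ (shift-summand (suc h) i (suc N) k))) ⟨
    summand h i (suc N) k + shift (summand (suc h) i (suc N)) k
      + (1# - q ^ suc h) * (summand (suc (suc h)) i N k - summand (suc h) i N k)
      + boundary h i (suc N) k ∎
    where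
    p   = h ℕ.+ i
    Q   = q ^ i
    y   = q ^ h
    c   = gauss (suc h) i
    c₀  = gauss h i
    c₀′ = gauss h (suc i)
    c₂  = gauss (suc (suc h)) i
    x₀  = X i p (suc N) k
    x₁′ = X i (suc p) (suc N) k
    κ   = shift (X i (suc p) (suc N)) k
    x₁  = X i (suc p) N k
    x₂  = X i (suc (suc p)) N k
    x₁′≈ : x₁′ ≈ x₀ + κ + x₂ - x₁
    x₁′≈ = begin
      x₁′                ≈⟨ solve 2 (λ a b → a := a :+ b :- b) refl x₁′ x₁ ⟩
      x₁′ + x₁ - x₁      ≈⟨ +-congʳ (X-rec i p (suc N) k) ⟩
      x₀ + κ + x₂ - x₁   ∎

  -- Adding up `summand-rec` over i, i + 1, ... cancels all boundaries but the first. The degree `N`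
  -- in z drops with every term, which ends the sum.
  tail-rec : ∀ h i N k →
    tail (suc h) i N k
      ≈ tail h i N k + shift (tail (suc h) i N) k
        + (1# - q ^ suc h) * (shift (λ N → tail (suc (suc h)) i N k) N - shift (λ N → tail (suc h) i N k) N)
        + boundary h i N k
  tail-rec h i zero k = begin
    Q * (c * x₁)
      ≈⟨ *-congˡ (*-congˡ (trans (sym (+-identityʳ _)) (trans (X-rec i p 0 k) (+-identityʳ _)))) ⟩
    Q * (c * (x₀ + κ))
      ≈⟨ solve 6 (λ Q c c₀ x₀ κ w → Q :* (c :* (x₀ :+ κ))
           := Q :* (c₀ :* x₀) :+ Q :* (c :* κ) :+ w :* (con (+ 0) :- con (+ 0)) :+ (c :- c₀) :* (Q :* x₀))
           refl Q c c₀ x₀ κ (1# - q ^ suc h) ⟩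
    Q * (c₀ * x₀) + Q * (c * κ) + (1# - q ^ suc h) * (ι (+ 0) - ι (+ 0)) + (c - c₀) * (Q * x₀)
      ≈⟨ +-congʳ (+-cong (+-congˡ (sym (shift-summand (suc h) i 0 k)))
           (*-congˡ (+-cong 0-homo (-‿cong 0-homo)))) ⟩
    tail h i 0 k + shift (tail (suc h) i 0) k + (1# - q ^ suc h) * (0# - 0#) + boundary h i 0 k ∎
    where
    p  = h ℕ.+ i
    Q  = q ^ i
    c  = gauss (suc h) i
    c₀ = gauss h i
    x₀ = X i p 0 k
    x₁ = X i (suc p) 0 k
    κ  = shift (X i (suc p) 0) k
  tail-rec h i (suc N) k = begin
    s₁ + tail (suc h) (suc i) N k
      ≈⟨ +-congˡ (tail-rec h (suc i) N k) ⟩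
    s₁ + (t₀ + a₁ + w * (z₂ - z₁) + d′)
      ≈⟨ solve 6 (λ s₁ d′ t₀ a₁ w z → s₁ :+ (t₀ :+ a₁ :+ w :* z :+ d′)
           := (s₁ :+ d′) :+ (t₀ :+ a₁ :+ w :* z)) refl s₁ d′ t₀ a₁ w (z₂ - z₁) ⟩
    (s₁ + d′) + (t₀ + a₁ + w * (z₂ - z₁))
      ≈⟨ +-congʳ (summand-rec h i N k) ⟩
    (s₀ + b₁ + w * (r₂ - r₁) + d) + (t₀ + a₁ + w * (z₂ - z₁))
      ≈⟨ solve 10 (λ s₀ b₁ w r₂ r₁ d t₀ a₁ z₂ z₁ →
           (s₀ :+ b₁ :+ w :* (r₂ :- r₁) :+ d) :+ (t₀ :+ a₁ :+ w :* (z₂ :- z₁))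
           := (s₀ :+ t₀) :+ (b₁ :+ a₁) :+ w :* ((r₂ :+ z₂) :- (r₁ :+ z₁)) :+ d)
           refl s₀ b₁ w r₂ r₁ d t₀ a₁ z₂ z₁ ⟩
    (s₀ + t₀) + (b₁ + a₁) + w * ((r₂ + z₂) - (r₁ + z₁)) + d
      ≈⟨ +-congʳ (+-cong (+-congˡ (shift-+ _ _ k))
           (*-congˡ (+-cong (tail-unfold (suc (suc h)) i N k) (-‿cong (tail-unfold (suc h) i N k))))) ⟨
    tail h i (suc N) k + shift (tail (suc h) i (suc N)) k
      + w * (tail (suc (suc h)) i N k - tail (suc h) i N k) + d ∎
    where
    w  = 1# - q ^ suc h
    s₁ = summand (suc h) i (suc N) k
    s₀ = summand h i (suc N) k
    b₁ = shift (summand (suc h) i (suc N)) k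
    r₂ = summand (suc (suc h)) i N k
    r₁ = summand (suc h) i N k
    t₀ = tail h (suc i) N k
    a₁ = shift (tail (suc h) (suc i) N) k
    z₂ = shift (λ N → tail (suc (suc h)) (suc i) N k) N
    z₁ = shift (λ N → tail (suc h) (suc i) N k) N
    d′ = boundary h (suc i) N k
    d  = boundary h i (suc N) k

  -- Expansion of g₁ as a double sum.

  ∑-upTo-suc : ∀ n (f : ℕ → Carrier) → ∑ (upTo (suc n)) f ≡ f 0 + ∑ (upTo n) (f ∘ suc)
  ∑-upTo-suc n f = ≡.cong (λ xs → f 0 + foldr _+_ 0# xs)
    (≡.trans (L.map-applyUpTo suc f n) (≡.sym (L.map-applyUpTo id (f ∘ suc) n)))

  ∑-upTo-cong : ∀ n {f g : ℕ → Carrier} → (∀ i → i < n → f i ≈ g i) → ∑ (upTo n) f ≈ ∑ (upTo n) g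
  ∑-upTo-cong zero    e = refl
  ∑-upTo-cong (suc n) {f} {g} e = begin
    ∑ (upTo (suc n)) f          ≡⟨ ∑-upTo-suc n f ⟩
    f 0 + ∑ (upTo n) (f ∘ suc)  ≈⟨ +-cong (e 0 (s≤s z≤n)) (∑-upTo-cong n (λ i i<n → e (suc i) (s≤s i<n))) ⟩
    g 0 + ∑ (upTo n) (g ∘ suc)  ≡⟨ ∑-upTo-suc n g ⟨
    ∑ (upTo (suc n)) g          ∎

  ∑-upTo-last : ∀ n (f : ℕ → Carrier) → ∑ (upTo (suc n)) f ≈ ∑ (upTo n) f + f n
  ∑-upTo-last n f = begin
    ∑ (upTo (suc n)) f         ≡⟨ ≡.cong (λ xs → ∑ xs f) (L.upTo-∷ʳ n) ⟨
    ∑ (upTo n ++ n ∷ []) f     ≈⟨ ∑-++ f (upTo n) (n ∷ []) ⟩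
    ∑ (upTo n) f + (f n + 0#)  ≈⟨ +-congˡ (+-identityʳ (f n)) ⟩
    ∑ (upTo n) f + f n         ∎

  ∑-upTo-drop : ∀ M j (f : ℕ → Carrier) → (∀ i → i < j → f i ≈ 0#) →
    ∑ (upTo M) f ≈ ∑ (upTo (M ∸ j)) (λ d → f (j ℕ.+ d))
  ∑-upTo-drop M       zero    f e = refl
  ∑-upTo-drop zero    (suc j) f e = refl
  ∑-upTo-drop (suc M) (suc j) f e = begin
    ∑ (upTo (suc M)) f          ≡⟨ ∑-upTo-suc M f ⟩
    f 0 + ∑ (upTo M) (f ∘ suc)  ≈⟨ trans (+-congʳ (e 0 (s≤s z≤n))) (+-identityˡ _) ⟩
    ∑ (upTo M) (f ∘ suc)        ≈⟨ ∑-upTo-drop M j (f ∘ suc) (λ i i<j → e (suc i) (s≤s i<j)) ⟩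
    ∑ (upTo (M ∸ j)) (λ d → f (suc (j ℕ.+ d))) ∎

  -- The Gaussian binomials indexed by upper and lower entry, since the expansion of the product
  -- varies the lower entry under a fixed upper one.
  qbinom : ℕ → ℕ → Carrier
  qbinom i       zero    = 1#
  qbinom zero    (suc j) = 0#
  qbinom (suc i) (suc j) = qbinom i (suc j) + q ^ (i ∸ j) * qbinom i j

  qbinom-vanish : ∀ {i j} → i < j → qbinom i j ≈ 0#
  qbinom-vanish {zero}  {suc j} _         = refl
  qbinom-vanish {suc i} {suc j} (s≤s i<j) = trans
    (+-cong (qbinom-vanish (ℕ.m<n⇒m<1+n i<j)) (trans (*-congˡ (qbinom-vanish i<j)) (zeroʳ _)))
    (+-identityʳ 0#)

  qbinom-gauss : ∀ a j → qbinom (a ℕ.+ j) j ≈ gauss (suc a) j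
  qbinom-gauss a       zero    = refl
  qbinom-gauss zero    (suc j) = +-cong (qbinom-vanish (ℕ.n<1+n j))
    (*-cong (≡⇒≈ (≡.cong (q ^_) (ℕ.n∸n≡0 j))) (qbinom-gauss zero j))
  qbinom-gauss (suc a) (suc j) = +-cong (qbinom-gauss a (suc j)) (begin
    q ^ (a ℕ.+ suc j ∸ j) * qbinom (a ℕ.+ suc j) j
      ≡⟨ ≡.cong (λ m → q ^ (m ∸ j) * qbinom m j) (ℕ.+-suc a j) ⟩
    q ^ (suc a ℕ.+ j ∸ j) * qbinom (suc a ℕ.+ j) j
      ≡⟨ ≡.cong (λ m → q ^ m * qbinom (suc a ℕ.+ j) j) (ℕ.m+n∸n≡m (suc a) j) ⟩
    q ^ suc a * qbinom (suc a ℕ.+ j) j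
      ≈⟨ *-congˡ (qbinom-gauss (suc a) j) ⟩
    q ^ suc a * gauss (suc (suc a)) j ∎)

  -- The coefficient of vʲ in (1 − v) (1 − q v) ⋯ (1 − qⁱ⁻¹ v).
  coefficient : ℕ → ℕ → Carrier
  coefficient i j = ι (-1ℤ ℤ.^ j) * (q ^ (j C 2) * qbinom i j)

  -- The exponents agree because the binomial of j + 1 over 2 exceeds that of j over 2 by j. For j >
  -- i the subtraction is truncated, but then `qbinom` is zero.
  powers : ∀ i j → q ^ (suc j C 2) * (q ^ (i ∸ j) * qbinom i j) ≈ q ^ i * (q ^ (j C 2) * qbinom i j)
  powers i j with j ℕ.≤? i
  ... | yes j≤i = begin
    q ^ (suc j C 2) * (q ^ (i ∸ j) * qbinom i j)
      ≈⟨ *-assoc _ _ _ ⟨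
    q ^ (suc j C 2) * q ^ (i ∸ j) * qbinom i j
      ≈⟨ *-congʳ (^-homo-* q (suc j C 2) (i ∸ j)) ⟨
    q ^ (suc j C 2 ℕ.+ (i ∸ j)) * qbinom i j
      ≡⟨ ≡.cong (λ m → q ^ m * qbinom i j) exponent ⟩
    q ^ (i ℕ.+ j C 2) * qbinom i j
      ≈⟨ trans (*-congʳ (^-homo-* q i (j C 2))) (*-assoc _ _ _) ⟩
    q ^ i * (q ^ (j C 2) * qbinom i j) ∎
    where
    exponent : suc j C 2 ℕ.+ (i ∸ j) ≡ i ℕ.+ j C 2
    exponent = ≡.trans (≡.cong (ℕ._+ (i ∸ j)) (≡.trans (≡.sym (nCk+nC[k+1]≡[n+1]C[k+1] j 1))
        (≡.trans (≡.cong (ℕ._+ j C 2) (nC1≡n j)) (ℕ.+-comm j (j C 2)))))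
      (≡.trans (ℕ.+-assoc (j C 2) j (i ∸ j)) (≡.trans (≡.cong (j C 2 ℕ.+_) (ℕ.m+[n∸m]≡n j≤i))
        (ℕ.+-comm (j C 2) i)))
  ... | no  j≰i = trans (*-congˡ (trans (*-congˡ vanish) (zeroʳ _)))
                    (trans (zeroʳ _) (sym (trans (*-congˡ (trans (*-congˡ vanish) (zeroʳ _))) (zeroʳ _))))
    where vanish = qbinom-vanish (ℕ.≰⇒> j≰i)

  ι-sign-suc : ∀ j → ι (-1ℤ ℤ.^ suc j) ≈ - ι (-1ℤ ℤ.^ j)
  ι-sign-suc j = trans (≡⇒≈ (≡.cong ι (ℤ.-1*i≡-i (-1ℤ ℤ.^ j)))) (-‿homo _)

  -- Multiplication of the product by its next factor 1 - qⁱ v.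
  coefficient-suc : ∀ i j → coefficient (suc i) (suc j) ≈ coefficient i (suc j) - q ^ i * coefficient i j
  coefficient-suc i j = begin
    s′ * (q ^ (suc j C 2) * (qbinom i (suc j) + q ^ (i ∸ j) * qbinom i j))
      ≈⟨ trans (*-congˡ (distribˡ _ _ _)) (distribˡ _ _ _) ⟩
    coefficient i (suc j) + s′ * (q ^ (suc j C 2) * (q ^ (i ∸ j) * qbinom i j))
      ≈⟨ +-congˡ (*-cong (ι-sign-suc j) (powers i j)) ⟩
    coefficient i (suc j) + - s * (q ^ i * (q ^ (j C 2) * qbinom i j))
      ≈⟨ +-congˡ (solve 4 (λ s a b c → :- s :* (a :* (b :* c)) := :- (a :* (s :* (b :* c)))) refl
           s (q ^ i) (q ^ (j C 2)) (qbinom i j)) ⟩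
    coefficient i (suc j) - q ^ i * coefficient i j ∎
    where
    s  = ι (-1ℤ ℤ.^ j)
    s′ = ι (-1ℤ ℤ.^ suc j)

  coefficient-zero : ∀ i → coefficient i 0 ≈ 1#
  coefficient-zero i = trans (*-cong 1-homo (*-identityˡ _)) (*-identityˡ 1#)

  -- The q-binomial theorem. The bound `M` is arbitrary above i, so that all i can share one range
  -- of j and the two sums can be interchanged.
  X-expand : ∀ i p N k M → i < M →
    X i p N k ≈ ∑ (upTo M) (λ j → coefficient i j * ι (V (p ℕ.+ j) N k))
  X-expand zero p N k (suc M) _ = begin
    ι (V p N k)
      ≡⟨ ≡.cong (λ p → ι (V p N k)) (ℕ.+-identityʳ p) ⟨
    ι (V (p ℕ.+ 0) N k)
      ≈⟨ trans (*-congʳ (coefficient-zero 0)) (*-identityˡ _) ⟨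
    coefficient 0 0 * ι (V (p ℕ.+ 0) N k)
      ≈⟨ trans (+-congˡ (trans (∑-cong (upTo M) (λ j → trans (*-congʳ (trans (*-congˡ (zeroʳ _)) (zeroʳ _))) (zeroˡ _)))
           (∑-zero (upTo M)))) (+-identityʳ _) ⟨
    coefficient 0 0 * ι (V (p ℕ.+ 0) N k) + ∑ (upTo M) (λ j → coefficient 0 (suc j) * ι (V (p ℕ.+ suc j) N k))
      ≡⟨ ∑-upTo-suc M (λ j → coefficient 0 j * ι (V (p ℕ.+ j) N k)) ⟨
    ∑ (upTo (suc M)) (λ j → coefficient 0 j * ι (V (p ℕ.+ j) N k)) ∎
  X-expand (suc i) p N k (suc M) (s≤s i<M) = begin
    X i p N k - q ^ i * X i (suc p) N k
      ≈⟨ +-cong (X-expand i p N k (suc M) (ℕ.m<n⇒m<1+n i<M))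
           (-‿cong (*-congˡ (X-expand i (suc p) N k M i<M))) ⟩
    ∑ (upTo (suc M)) (f i) - q ^ i * ∑ (upTo M) g
      ≈⟨ +-congʳ (≡⇒≈ (∑-upTo-suc M (f i))) ⟩
    f i 0 + ∑ (upTo M) (f i ∘ suc) - q ^ i * ∑ (upTo M) g
      ≈⟨ solve 4 (λ a b c d → a :+ b :- c :* d := a :+ (b :+ :- c :* d)) refl
           (f i 0) (∑ (upTo M) (f i ∘ suc)) (q ^ i) (∑ (upTo M) g) ⟩
    f i 0 + (∑ (upTo M) (f i ∘ suc) + - (q ^ i) * ∑ (upTo M) g)
      ≈⟨ +-congˡ (+-congˡ (∑-* (- (q ^ i)) g (upTo M))) ⟨
    f i 0 + (∑ (upTo M) (f i ∘ suc) + ∑ (upTo M) (λ j → - (q ^ i) * g j))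
      ≈⟨ +-congˡ (∑-+ (f i ∘ suc) (λ j → - (q ^ i) * g j) (upTo M)) ⟨
    f i 0 + ∑ (upTo M) (λ j → f i (suc j) + - (q ^ i) * g j)
      ≈⟨ +-cong (*-congʳ (trans (coefficient-zero i) (sym (coefficient-zero (suc i))))) (∑-cong (upTo M) step) ⟩
    f (suc i) 0 + ∑ (upTo M) (f (suc i) ∘ suc)
      ≡⟨ ∑-upTo-suc M (f (suc i)) ⟨
    ∑ (upTo (suc M)) (f (suc i)) ∎
    where
    f : ℕ → ℕ → Carrier
    f i j = coefficient i j * ι (V (p ℕ.+ j) N k)
    g : ℕ → Carrier
    g j = coefficient i j * ι (V (suc p ℕ.+ j) N k)
    step : ∀ j → f i (suc j) + - (q ^ i) * g j ≈ f (suc i) (suc j)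
    step j = begin
      f i (suc j) + - (q ^ i) * (coefficient i j * ι (V (suc p ℕ.+ j) N k))
        ≡⟨ ≡.cong (λ p → f i (suc j) + - (q ^ i) * (coefficient i j * ι (V p N k))) (ℕ.+-suc p j) ⟨
      coefficient i (suc j) * x + - (q ^ i) * (coefficient i j * x)
        ≈⟨ solve 4 (λ a b c x → a :* x :+ :- b :* (c :* x) := (a :- b :* c) :* x) refl
             (coefficient i (suc j)) (q ^ i) (coefficient i j) x ⟩
      (coefficient i (suc j) - q ^ i * coefficient i j) * x
        ≈⟨ *-congʳ (coefficient-suc i j) ⟨
      coefficient (suc i) (suc j) * x ∎
      where x = ι (V (p ℕ.+ suc j) N k)

  gauss-one : ∀ i → gauss 1 i ≈ 1#
  gauss-one zero    = refl
  gauss-one (suc i) = trans (+-identityˡ _) (trans (*-identityˡ _) (gauss-one i))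

  tail-sum : ∀ i N k →
    tail 1 i N k ≈ ∑ (upTo (suc N)) (λ d → q ^ (i ℕ.+ d) * X (i ℕ.+ d) (suc (i ℕ.+ d)) (N ∸ d) k)
  tail-sum i N k = begin
    tail 1 i N k
      ≈⟨ tail-unfold 1 i N k ⟩
    q ^ i * (gauss 1 i * X i (suc i) N k) + shift (λ N → tail 1 (suc i) N k) N
      ≈⟨ +-congʳ (*-congˡ (trans (*-congʳ (gauss-one i)) (*-identityˡ _))) ⟩
    q ^ i * X i (suc i) N k + shift (λ N → tail 1 (suc i) N k) N
      ≡⟨ ≡.cong (λ j → q ^ j * X j (suc j) N k + shift (λ N → tail 1 (suc i) N k) N) (ℕ.+-identityʳ i) ⟨
    f N 0 + shift (λ N → tail 1 (suc i) N k) N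
      ≈⟨ +-congˡ (rest N) ⟩
    f N 0 + ∑ (upTo N) (f N ∘ suc)
      ≡⟨ ∑-upTo-suc N (f N) ⟨
    ∑ (upTo (suc N)) (f N) ∎
    where
    f : ℕ → ℕ → Carrier
    f N d = q ^ (i ℕ.+ d) * X (i ℕ.+ d) (suc (i ℕ.+ d)) (N ∸ d) k
    rest : ∀ N → shift (λ N → tail 1 (suc i) N k) N ≈ ∑ (upTo N) (f N ∘ suc)
    rest zero    = refl
    rest (suc N) = trans (tail-sum (suc i) N k) (∑-cong (upTo (suc N)) (λ d →
      ≡⇒≈ (≡.cong (λ j → q ^ j * X j (suc j) (N ∸ d) k) (≡.sym (ℕ.+-suc i d)))))

  tail-double-sum : ∀ N k →
    tail 1 0 N k ≈ ∑ (upTo (suc N)) (λ j → ∑ (upTo (suc N ∸ j)) (λ d →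
      ι (-1ℤ ℤ.^ j) * ι (V (suc (j ℕ.+ d ℕ.+ j)) (N ∸ (j ℕ.+ d)) k)
        * (q ^ (j ℕ.+ d ℕ.+ j C 2) * gauss (suc d) j)))
  tail-double-sum N k = begin
    tail 1 0 N k
      ≈⟨ tail-sum 0 N k ⟩
    ∑ (upTo (suc N)) (λ i → q ^ i * X i (suc i) (N ∸ i) k)
      ≈⟨ ∑-upTo-cong (suc N) (λ i i≤N → trans (*-congˡ (X-expand i (suc i) (N ∸ i) k (suc N) i≤N))
           (sym (∑-* (q ^ i) (λ j → coefficient i j * v i j) (upTo (suc N))))) ⟩
    ∑ (upTo (suc N)) (λ i → ∑ (upTo (suc N)) (f i))
      ≈⟨ ∑-swap f (upTo (suc N)) (upTo (suc N)) ⟩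
    ∑ (upTo (suc N)) (λ j → ∑ (upTo (suc N)) (λ i → f i j))
      -- The terms with i < j are zero, which leaves i = j + d.
      ≈⟨ ∑-cong (upTo (suc N)) (λ j → ∑-upTo-drop (suc N) j (λ i → f i j) (λ i → f-vanish i j)) ⟩
    ∑ (upTo (suc N)) (λ j → ∑ (upTo (suc N ∸ j)) (λ d → f (j ℕ.+ d) j))
      ≈⟨ ∑-cong (upTo (suc N)) (λ j → ∑-cong (upTo (suc N ∸ j)) (step j)) ⟩
    _ ∎
    where
    v f : ℕ → ℕ → Carrier
    v i j = ι (V (suc i ℕ.+ j) (N ∸ i) k)
    f i j = q ^ i * (coefficient i j * v i j)
    f-vanish : ∀ i j → i < j → f i j ≈ 0#
    f-vanish i j i<j = trans (*-congˡ (trans (*-congʳ (trans (*-congˡ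
      (trans (*-congˡ (qbinom-vanish i<j)) (zeroʳ _))) (zeroʳ _))) (zeroˡ _))) (zeroʳ _)
    step : ∀ j d → f (j ℕ.+ d) j ≈ ι (-1ℤ ℤ.^ j) * v (j ℕ.+ d) j * (q ^ (j ℕ.+ d ℕ.+ j C 2) * gauss (suc d) j)
    step j d = begin
      q ^ i * (s * (q ^ (j C 2) * qbinom i j) * v i j)
        ≈⟨ solve 5 (λ a s b c v → a :* (s :* (b :* c) :* v) := s :* v :* (a :* b :* c)) refl
             (q ^ i) s (q ^ (j C 2)) (qbinom i j) (v i j) ⟩
      s * v i j * (q ^ i * q ^ (j C 2) * qbinom i j)
        ≈⟨ *-congˡ (*-cong (sym (^-homo-* q i (j C 2)))
             (trans (≡⇒≈ (≡.cong (λ i → qbinom i j) (ℕ.+-comm j d))) (qbinom-gauss d j))) ⟩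
      s * v i j * (q ^ (i ℕ.+ j C 2) * gauss (suc d) j) ∎
      where
      i = j ℕ.+ d
      s = ι (-1ℤ ℤ.^ j)

  -- Weighted completions of a pattern, and moves between patterns.

  ∑-shift : ∀ {S : Set} (f : S → ℕ → Carrier) xs k →
    ∑ xs (λ x → shift (f x) k) ≈ shift (λ k → ∑ xs (λ x → f x k)) k
  ∑-shift f xs zero    = ∑-zero xs
  ∑-shift f xs (suc k) = refl

  -- When `P` has `r` free letters, this is the sum of q to the total cost over all orders of
  -- reading them with `k` right-to-left maxima.
  W : ∀ {m} → Vec Bool m → (r k : ℕ) → Carrier
  W-term : ∀ {m} → Vec Bool m → (r k : ℕ) → Fin m → Carrier
  W P zero    zero    = 1#
  W P zero    (suc k) = 0#
  W P (suc r) k       = ∑ (allFin _) (W-term P r k)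
  W-term P r k x = if lookup P x then 0# else
    q ^ cost P x * (if isTop P x then shift (W (P [ x ]≔ true) r) k else W (P [ x ]≔ true) r k)

  -- A used largest letter exceeds everything to come, so it is never charged, and it does not stop
  -- a later letter from being a right-to-left maximum.
  W-true∷ : ∀ {m} (P : Vec Bool m) r k → W (true ∷ P) r k ≈ W P r k
  W-true∷ P zero    zero    = refl
  W-true∷ P zero    (suc k) = refl
  W-true∷ P (suc r) k       = begin
    W (true ∷ P) (suc r) k  ≡⟨ ∑-allFin (W-term (true ∷ P) r k) ⟩
    0# + _                  ≈⟨ +-identityˡ _ ⟩
    ∑ (allFin _) (W-term (true ∷ P) r k ∘ suc) ≈⟨ ∑-cong (allFin _) step ⟩
    W P (suc r) k           ∎
    where
    step : ∀ x →
      (if lookup P x then 0# else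
        q ^ cost P x * (if isTop P x then shift (W (true ∷ P [ x ]≔ true) r) k else W (true ∷ P [ x ]≔ true) r k))
      ≈ (if lookup P x then 0# else
        q ^ cost P x * (if isTop P x then shift (W (P [ x ]≔ true) r) k else W (P [ x ]≔ true) r k))
    step x with lookup P x | isTop P x
    ... | true  | _     = refl
    ... | false | true  = *-congˡ (shift-cong (W-true∷ (P [ x ]≔ true) r) k)
    ... | false | false = *-congˡ (W-true∷ (P [ x ]≔ true) r k)

  move-term : ∀ {m} → Vec Bool m → (Vec Bool m → Carrier) → Fin m → Carrier
  move-term P φ x = if lookup P x then 0# else q ^ above P x * φ (P [ x ]≔ true)

  moves : ∀ {m} → Vec Bool m → (Vec Bool m → Carrier) → Carrier
  moves P φ = ∑ (allFin _) (move-term P φ)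

  -- While the largest letter is free, it alone can become a right-to-left maximum, at no cost. Any
  -- other letter is charged for all larger used ones, which is what `moves` records.
  W-false∷ : ∀ {m} (P : Vec Bool m) r k →
    W (false ∷ P) (suc r) k ≈ shift (W P r) k + moves P (λ Q → W (false ∷ Q) r k)
  W-false∷ P r k = begin
    W (false ∷ P) (suc r) k
      ≡⟨ ∑-allFin (W-term (false ∷ P) r k) ⟩
    1# * shift (W (true ∷ P) r) k + moves P (λ Q → W (false ∷ Q) r k)
      ≈⟨ +-congʳ (trans (*-identityˡ _) (shift-cong (W-true∷ P r) k)) ⟩
    shift (W P r) k + moves P (λ Q → W (false ∷ Q) r k) ∎

  moves-true∷ : ∀ {m} (P : Vec Bool m) φ → moves (true ∷ P) φ ≈ q * moves P (φ ∘ (true ∷_))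
  moves-true∷ P φ = begin
    moves (true ∷ P) φ                             ≡⟨ ∑-allFin (move-term (true ∷ P) φ) ⟩
    0# + _                                         ≈⟨ +-identityˡ _ ⟩
    ∑ (allFin _) (move-term (true ∷ P) φ ∘ suc)    ≈⟨ ∑-cong (allFin _) step ⟩
    ∑ (allFin _) (λ x → q * move-term P (φ ∘ (true ∷_)) x) ≈⟨ ∑-* q (move-term P (φ ∘ (true ∷_))) (allFin _) ⟩
    q * moves P (φ ∘ (true ∷_)) ∎
    where
    step : ∀ x →
      (if lookup P x then 0# else q * q ^ above P x * φ (true ∷ P [ x ]≔ true))
      ≈ q * (if lookup P x then 0# else q ^ above P x * φ (true ∷ P [ x ]≔ true))
    step x with lookup P x
    ... | true  = sym (zeroʳ q)
    ... | false = *-assoc _ _ _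

  moves-false∷ : ∀ {m} (P : Vec Bool m) φ →
    moves (false ∷ P) φ ≈ φ (true ∷ P) + moves P (φ ∘ (false ∷_))
  moves-false∷ P φ = trans (≡⇒≈ (∑-allFin (move-term (false ∷ P) φ))) (+-congʳ (*-identityˡ _))

  moves-full : ∀ m φ → ∑ (patterns m 0) (λ P → moves P φ) ≈ 0#
  moves-full zero    φ = +-identityʳ 0#
  moves-full (suc m) φ = begin
    ∑ (patterns (suc m) 0) (λ P → moves P φ)            ≡⟨ ∑-map _ _ (patterns m 0) ⟩
    ∑ (patterns m 0) (λ P → moves (true ∷ P) φ)         ≈⟨ ∑-cong (patterns m 0) (λ P → moves-true∷ P φ) ⟩
    ∑ (patterns m 0) (λ P → q * moves P (φ ∘ (true ∷_))) ≈⟨ ∑-* q (λ P → moves P (φ ∘ (true ∷_))) (patterns m 0) ⟩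
    q * ∑ (patterns m 0) (λ P → moves P (φ ∘ (true ∷_))) ≈⟨ *-congˡ (moves-full m (φ ∘ (true ∷_))) ⟩
    q * 0#                                              ≈⟨ zeroʳ q ⟩
    0#                                                  ∎

  -- Each pattern Q with r free letters arises by one move from its m − r used letters, and
  -- the numbers of used letters above these are 0, 1, …, m − r − 1.
  ∑-moves : ∀ m r φ → ∑ (patterns m (suc r)) (λ P → moves P φ) ≈ [ m ∸ r ] * ∑ (patterns m r) φ
  ∑-moves zero zero    φ = sym (zeroˡ _)
  ∑-moves zero (suc r) φ = sym (zeroʳ _)
  ∑-moves (suc m) r φ = begin
    ∑ (patterns (suc m) (suc r)) (λ P → moves P φ)
      ≈⟨ trans (∑-++ _ (map (true ∷_) (patterns m (suc r))) _)
           (+-cong (≡⇒≈ (∑-map _ _ (patterns m (suc r)))) (≡⇒≈ (∑-map _ _ (patterns m r)))) ⟩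
    ∑ (patterns m (suc r)) (λ P → moves (true ∷ P) φ) + ∑ (patterns m r) (λ P → moves (false ∷ P) φ)
      ≈⟨ +-cong (trans (∑-cong (patterns m (suc r)) (λ P → moves-true∷ P φ)) (∑-* q (λ P → moves P (φ ∘ (true ∷_))) (patterns m (suc r))))
           (trans (∑-cong (patterns m r) (λ P → moves-false∷ P φ)) (∑-+ _ _ (patterns m r))) ⟩
    q * ∑ (patterns m (suc r)) (λ P → moves P (φ ∘ (true ∷_)))
      + (S + ∑ (patterns m r) (λ P → moves P (φ ∘ (false ∷_))))
      ≈⟨ +-assoc _ _ _ ⟨
    q * ∑ (patterns m (suc r)) (λ P → moves P (φ ∘ (true ∷_)))
      + S + ∑ (patterns m r) (λ P → moves P (φ ∘ (false ∷_)))
      -- Patterns with a used largest letter arise by reading that letter, with charge 0, or by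
      -- reading another one below it, with one more charge: hence 1 + q [m - r].
      ≈⟨ +-congʳ (trans (+-congʳ (trans (*-congˡ (∑-moves m r (φ ∘ (true ∷_)))) (sym (*-assoc _ _ _))))
           (trans (+-comm _ _) (trans (+-congʳ (sym (*-identityˡ S))) (sym (distribʳ _ _ _))))) ⟩
    (1# + q * [ m ∸ r ]) * S + ∑ (patterns m r) (λ P → moves P (φ ∘ (false ∷_)))
      ≈⟨ rest r ⟩
    [ suc m ∸ r ] * ∑ (patterns (suc m) r) φ ∎
    where
    S = ∑ (patterns m r) (φ ∘ (true ∷_))
    -- For m ≤ r the truncated difference would spoil the step from one q-integer to the next, but
    -- then there are no patterns to sum over.
    absorb : ∀ r → (1# + q * [ m ∸ suc r ]) * ∑ (patterns m (suc r)) (φ ∘ (true ∷_))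
      ≈ [ m ∸ r ] * ∑ (patterns m (suc r)) (φ ∘ (true ∷_))
    absorb r with suc r ℕ.≤? m
    ... | yes r<m = *-congʳ (trans (sym ([]-suc (m ∸ suc r)))
                      (≡⇒≈ (≡.cong [_] (≡.sym (ℕ.+-∸-assoc 1 r<m)))))
    ... | no  r≮m rewrite patterns-empty (ℕ.≰⇒> r≮m) = trans (zeroʳ _) (sym (zeroʳ _))
    rest : ∀ r → (1# + q * [ m ∸ r ]) * ∑ (patterns m r) (φ ∘ (true ∷_))
        + ∑ (patterns m r) (λ P → moves P (φ ∘ (false ∷_)))
      ≈ [ suc m ∸ r ] * ∑ (patterns (suc m) r) φ
    rest zero = begin
      (1# + q * [ m ]) * _ + _  ≈⟨ +-cong (*-congʳ (sym ([]-suc m))) (moves-full m (φ ∘ (false ∷_))) ⟩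
      [ suc m ] * _ + 0#        ≈⟨ +-identityʳ _ ⟩
      [ suc m ] * _             ≡⟨ ≡.cong ([ suc m ] *_) (∑-map φ _ (patterns m 0)) ⟨
      [ suc m ] * ∑ (patterns (suc m) 0) φ ∎
    rest (suc r) = begin
      (1# + q * [ m ∸ suc r ]) * _ + ∑ (patterns m (suc r)) (λ P → moves P (φ ∘ (false ∷_)))
        ≈⟨ +-cong (absorb r) (∑-moves m r (φ ∘ (false ∷_))) ⟩
      [ m ∸ r ] * ∑ (patterns m (suc r)) (φ ∘ (true ∷_)) + [ m ∸ r ] * ∑ (patterns m r) (φ ∘ (false ∷_))
        ≈⟨ distribˡ _ _ _ ⟨
      [ m ∸ r ] * (∑ (patterns m (suc r)) (φ ∘ (true ∷_)) + ∑ (patterns m r) (φ ∘ (false ∷_)))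
        ≈⟨ *-congˡ (trans (∑-++ φ (map (true ∷_) (patterns m (suc r))) _)
             (+-cong (≡⇒≈ (∑-map _ _ (patterns m (suc r)))) (≡⇒≈ (∑-map _ _ (patterns m r))))) ⟨
      [ m ∸ r ] * ∑ (patterns (suc m) (suc r)) φ ∎

  -- Totals over all patterns with a given number of free letters.

  total : (m r k : ℕ) → Carrier
  total m r k = ∑ (patterns m r) (λ P → W P r k)

  -- The part of the total over suc m letters in which the largest letter is free, together with `r`
  -- of the others.
  totalFree : (m r k : ℕ) → Carrier
  totalFree m r k = ∑ (patterns m r) (λ P → W (false ∷ P) (suc r) k)

  total-suc-zero : ∀ m k → total (suc m) 0 k ≈ total m 0 k
  total-suc-zero m k = trans (≡⇒≈ (∑-map _ _ (patterns m 0))) (∑-cong (patterns m 0) (λ P → W-true∷ P 0 k))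

  total-suc-suc : ∀ m r k → total (suc m) (suc r) k ≈ total m (suc r) k + totalFree m r k
  total-suc-suc m r k = trans (∑-++ _ (map (true ∷_) (patterns m (suc r))) _)
    (+-cong (trans (≡⇒≈ (∑-map _ _ (patterns m (suc r)))) (∑-cong (patterns m (suc r)) (λ P → W-true∷ P (suc r) k)))
            (≡⇒≈ (∑-map _ _ (patterns m r))))

  totalFree-moves : ∀ m r k →
    totalFree m r k ≈ shift (total m r) k + ∑ (patterns m r) (λ P → moves P (λ Q → W (false ∷ Q) r k))
  totalFree-moves m r k = begin
    totalFree m r k
      ≈⟨ ∑-cong (patterns m r) (λ P → W-false∷ P r k) ⟩
    ∑ (patterns m r) (λ P → shift (W P r) k + moves P (λ Q → W (false ∷ Q) r k))
      ≈⟨ ∑-+ _ _ (patterns m r) ⟩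
    ∑ (patterns m r) (λ P → shift (W P r) k) + _
      ≈⟨ +-congʳ (∑-shift (λ P → W P r) (patterns m r) k) ⟩
    shift (total m r) k + _ ∎

  totalFree-zero : ∀ m k → totalFree m 0 k ≈ shift (total m 0) k
  totalFree-zero m k = trans (totalFree-moves m 0 k) (trans (+-congˡ (moves-full m (λ Q → W (false ∷ Q) 0 k))) (+-identityʳ _))

  -- Reading the largest letter gives the first term, and any other letter leaves it free. By
  -- `∑-moves` only the number of used letters matters after summation; here the process forgets
  -- which letters they are.
  totalFree-suc : ∀ m r k → totalFree m (suc r) k ≈ shift (total m (suc r)) k + [ m ∸ r ] * totalFree m r k
  totalFree-suc m r k = trans (totalFree-moves m (suc r) k) (+-congˡ (∑-moves m r (λ Q → W (false ∷ Q) (suc r) k)))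

  total-zero-zero : ∀ m → total m 0 0 ≈ 1#
  total-zero-zero zero    = +-identityʳ 1#
  total-zero-zero (suc m) = trans (total-suc-zero m 0) (total-zero-zero m)

  -- Each letter read gives at most one right-to-left maximum. This settles degree 0 in z, where
  -- `total-closed` has no factor 1 - q to spend.
  total-vanish : ∀ r m k → r < k → total m r k ≈ 0#
  totalFree-vanish : ∀ r m k → suc r < k → totalFree m r k ≈ 0#
  total-vanish zero    zero    (suc k) _   = +-identityʳ 0#
  total-vanish zero    (suc m) k       r<k = trans (total-suc-zero m k) (total-vanish zero m k r<k)
  total-vanish (suc r) zero    k       r<k = refl
  total-vanish (suc r) (suc m) k       r<k = trans (total-suc-suc m r k)
    (trans (+-cong (total-vanish (suc r) m k r<k) (totalFree-vanish r m k r<k)) (+-identityʳ 0#))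
  totalFree-vanish zero    m (suc k) (s≤s r<k) = trans (totalFree-zero m (suc k)) (total-vanish zero m k r<k)
  totalFree-vanish (suc r) m (suc k) (s≤s r<k) = trans (totalFree-suc m r (suc k))
    (trans (+-cong (total-vanish (suc r) m k r<k)
                   (trans (*-congˡ (totalFree-vanish r m (suc k) (ℕ.m<n⇒m<1+n r<k))) (zeroʳ _)))
      (+-identityʳ 0#))

  -- From permutations to completions of the empty pattern.

  ∑-filter : ∀ {S : Set} {Q : Pred S 0ℓ} (Q? : Decidable Q) (f : S → Carrier) xs →
    ∑ (filter Q? xs) f ≈ ∑ xs (λ x → if does (Q? x) then f x else 0#)
  ∑-filter Q? f []       = refl
  ∑-filter Q? f (x ∷ xs) with does (Q? x)
  ... | true  = +-congˡ (∑-filter Q? f xs)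
  ... | false = trans (∑-filter Q? f xs) (sym (+-identityˡ _))

  ∑-concatMap : ∀ {S T : Set} (g : S → List T) (f : T → Carrier) xs →
    ∑ (concatMap g xs) f ≈ ∑ xs (λ x → ∑ (g x) f)
  ∑-concatMap g f []       = refl
  ∑-concatMap g f (x ∷ xs) = trans (∑-++ f (g x) (concatMap g xs)) (+-congˡ (∑-concatMap g f xs))

  ∑-words : ∀ l m (f : Vec (Fin m) (suc l) → Carrier) →
    ∑ (words (suc l) m) f ≈ ∑ (allFin m) (λ x → ∑ (words l m) (λ w → f (x ∷ w)))
  ∑-words l m f = trans (∑-concatMap (λ x → map (x ∷_) (words l m)) f (allFin m))
    (∑-cong (allFin m) λ x → ≡⇒≈ (∑-map f (x ∷_) (words l m)))

  ∑-allFin-last : ∀ n (f : Fin (suc n) → Carrier) →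
    ∑ (allFin (suc n)) f ≈ ∑ (allFin n) (f ∘ inject₁) + f (fromℕ n)
  ∑-allFin-last zero    f = +-comm _ _
  ∑-allFin-last (suc n) f = begin
    ∑ (allFin (suc (suc n))) f
      ≡⟨ ∑-allFin f ⟩
    f zero + ∑ (allFin (suc n)) (f ∘ suc)
      ≈⟨ +-congˡ (∑-allFin-last n (f ∘ suc)) ⟩
    f zero + (∑ (allFin n) (f ∘ suc ∘ inject₁) + f (fromℕ (suc n)))
      ≈⟨ +-assoc _ _ _ ⟨
    f zero + ∑ (allFin n) (f ∘ suc ∘ inject₁) + f (fromℕ (suc n))
      ≡⟨ ≡.cong (_+ f (fromℕ (suc n))) (∑-allFin (f ∘ inject₁)) ⟨
    ∑ (allFin (suc n)) (f ∘ inject₁) + f (fromℕ (suc n)) ∎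

  ∑-opposite : ∀ n (f : Fin n → Carrier) → ∑ (allFin n) f ≈ ∑ (allFin n) (f ∘ opposite)
  ∑-opposite zero    f = refl
  ∑-opposite (suc n) f = begin
    ∑ (allFin (suc n)) f                                 ≈⟨ ∑-allFin-last n f ⟩
    ∑ (allFin n) (f ∘ inject₁) + f (fromℕ n)             ≈⟨ +-comm _ _ ⟩
    f (fromℕ n) + ∑ (allFin n) (f ∘ inject₁)             ≈⟨ +-congˡ (∑-opposite n (f ∘ inject₁)) ⟩
    f (fromℕ n) + ∑ (allFin n) (f ∘ inject₁ ∘ opposite)  ≡⟨ ∑-allFin (f ∘ opposite) ⟨
    ∑ (allFin (suc n)) (f ∘ opposite)                    ∎

  ∑-words-complement : ∀ l m (f : Vec (Fin m) l → Carrier) →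
    ∑ (words l m) f ≈ ∑ (words l m) (f ∘ Vec.map opposite)
  ∑-words-complement zero    m f = refl
  ∑-words-complement (suc l) m f = begin
    ∑ (words (suc l) m) f
      ≈⟨ ∑-words l m f ⟩
    ∑ (allFin m) (λ x → ∑ (words l m) (λ w → f (x ∷ w)))
      ≈⟨ ∑-opposite m (λ x → ∑ (words l m) (λ w → f (x ∷ w))) ⟩
    ∑ (allFin m) (λ x → ∑ (words l m) (λ w → f (opposite x ∷ w)))
      ≈⟨ ∑-cong (allFin m) (λ x → ∑-words-complement l m (λ w → f (opposite x ∷ w))) ⟩
    ∑ (allFin m) (λ x → ∑ (words l m) (λ w → f (opposite x ∷ Vec.map opposite w)))
      ≈⟨ ∑-words l m (f ∘ Vec.map opposite) ⟨
    ∑ (words (suc l) m) (f ∘ Vec.map opposite) ∎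

  weight : ∀ {m l} → Vec Bool m → ℕ → Vec (Fin m) l → Carrier
  weight P k w = if valid P w then (if does (recordsFrom P w ℕ.≟ k) then q ^ costsFrom P w else 0#) else 0#

  weight-∷ : ∀ {m l} (P : Vec Bool m) k x (w : Vec (Fin m) l) → lookup P x ≡ false →
    weight P k (x ∷ w) ≈ q ^ cost P x *
      (if isTop P x then shift (λ k → weight (P [ x ]≔ true) k w) k else weight (P [ x ]≔ true) k w)
  weight-∷ P k x w px rewrite px with isTop P x | k
  ... | true | zero with valid (P [ x ]≔ true) w
  ...   | true  = sym (zeroʳ _)
  ...   | false = sym (zeroʳ _)
  weight-∷ P k x w px | true | suc k′ with valid (P [ x ]≔ true) w | does (recordsFrom (P [ x ]≔ true) w ℕ.≟ k′)
  ...   | false | _     = sym (zeroʳ _)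
  ...   | true  | false = sym (zeroʳ _)
  ...   | true  | true  = ^-homo-* q (cost P x) _
  weight-∷ P k x w px | false | k′ with valid (P [ x ]≔ true) w | does (recordsFrom (P [ x ]≔ true) w ℕ.≟ k′)
  ...   | false | _     = sym (zeroʳ _)
  ...   | true  | false = sym (zeroʳ _)
  ...   | true  | true  = ^-homo-* q (cost P x) _

  ∑-weight : ∀ {m} (P : Vec Bool m) r k → ∑ (words r m) (weight P k) ≈ W P r k
  ∑-weight P zero zero    = +-identityʳ 1#
  ∑-weight P zero (suc k) = +-identityʳ 0#
  ∑-weight {m} P (suc r) k = trans (∑-words r m (weight P k)) (∑-cong (allFin m) step)
    where
    free-step : ∀ x → lookup P x ≡ false → ∑ (words r m) (λ w → weight P k (x ∷ w)) ≈
      q ^ cost P x * (if isTop P x then shift (W (P [ x ]≔ true) r) k else W (P [ x ]≔ true) r k)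
    free-step x px = begin
      ∑ (words r m) (λ w → weight P k (x ∷ w))
        ≈⟨ ∑-cong (words r m) (λ w → weight-∷ P k x w px) ⟩
      ∑ (words r m) (λ w → q ^ cost P x * next w)
        ≈⟨ ∑-* (q ^ cost P x) next (words r m) ⟩
      q ^ cost P x * ∑ (words r m) next
        ≈⟨ *-congˡ (collect (isTop P x)) ⟩
      q ^ cost P x * (if isTop P x then shift (W P′ r) k else W P′ r k) ∎
      where
      P′ = P [ x ]≔ true
      next : Vec (Fin m) r → Carrier
      next w = if isTop P x then shift (λ k → weight P′ k w) k else weight P′ k w
      collect : ∀ b → ∑ (words r m) (λ w → if b then shift (λ k → weight P′ k w) k else weight P′ k w)
        ≈ (if b then shift (W P′ r) k else W P′ r k)
      collect true  = trans (∑-shift (λ w k → weight P′ k w) (words r m) k)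
                        (shift-cong (λ k → ∑-weight P′ r k) k)
      collect false = ∑-weight P′ r k
    step : ∀ x → ∑ (words r m) (λ w → weight P k (x ∷ w)) ≈ W-term P r k x
    step x with lookup P x in px
    ... | true  = ∑-zero (words r m)
    -- The `with` has replaced `lookup P x` in the goal; `px` puts it back so that `free-step`
    -- applies.
    ... | false = trans (≡⇒≈ (≡.cong (λ b → ∑ (words r m) λ w →
                      if Data.Bool.not b ∧ valid (P [ x ]≔ true) w then
                        (if does (recordsFrom P (x ∷ w) ℕ.≟ k) then q ^ costsFrom P (x ∷ w) else 0#) else 0#)
                      (≡.sym px))) (free-step x px)

  -- Only one pattern has all its letters free: the one from which reading a permutation starts.
  total-diagonal : ∀ n k → total n n k ≈ W (replicate n false) n k
  total-diagonal n k = trans (≡⇒≈ (≡.cong (λ Ps → ∑ Ps (λ P → W P n k)) (only n))) (+-identityʳ _)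
    where
    only : ∀ n → patterns n n ≡ replicate n false ∷ []
    only zero = ≡.refl
    only (suc n) rewrite patterns-empty (ℕ.n<1+n n) | only n = ≡.refl

  ∑-perms : ∀ n k → ∑ (filter (λ σ → rlm σ ℕ.≟ k) (perms n)) (λ σ → q ^ inv′ σ) ≈ total n n k
  ∑-perms n k = begin
    ∑ (filter (λ σ → rlm σ ℕ.≟ k) (perms n)) (λ σ → q ^ inv′ σ)
      ≈⟨ ∑-filter (λ σ → rlm σ ℕ.≟ k) (λ σ → q ^ inv′ σ) (perms n) ⟩
    ∑ (filter injective? (words n n)) g
      ≈⟨ ∑-filter injective? g (words n n) ⟩
    ∑ (words n n) (λ σ → if does (injective? σ) then g σ else 0#)
      ≈⟨ ∑-words-complement n n (λ σ → if does (injective? σ) then g σ else 0#) ⟩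
    ∑ (words n n) (λ w → if does (injective? (Vec.map opposite w)) then g (Vec.map opposite w) else 0#)
      ≈⟨ ∑-cong (words n n) (λ w → ≡⇒≈ (agree w)) ⟩
    ∑ (words n n) (weight (replicate n false) k)
      ≈⟨ ∑-weight (replicate n false) n k ⟩
    W (replicate n false) n k
      ≈⟨ total-diagonal n k ⟨
    total n n k ∎
    where
    g : Vec (Fin n) n → Carrier
    g σ = if does (rlm σ ℕ.≟ k) then q ^ inv′ σ else 0#
    agree : ∀ w → (if does (injective? (Vec.map opposite w)) then g (Vec.map opposite w) else 0#)
      ≡ weight (replicate n false) k w
    agree w rewrite injective-complement w with valid (replicate n false) w in v
    ... | true  = ≡.cong₂ (λ a b → if does (a ℕ.≟ k) then q ^ b else 0#) (rlm-complement w v) (inv′-complement w v)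
    ... | false = ≡.refl

  -- Agreement of the totals with the coefficients of the series.

  tail-first : ∀ h → tail (suc h) 0 0 0 ≈ 1#
  tail-first h = begin
    1# * (1# * ι (V (suc (h ℕ.+ 0)) 0 0)) ≈⟨ trans (*-identityˡ _) (*-identityˡ _) ⟩
    ι (V (suc (h ℕ.+ 0)) 0 0)             ≡⟨ ≡.cong ι (V-zero-zero (suc (h ℕ.+ 0))) ⟩
    ι (+ 1)                               ≈⟨ 1-homo ⟩
    1#                                    ∎

  tail-zero-suc : ∀ i N k → tail 0 (suc i) N k ≈ 0#
  tail-zero-suc i zero    k = trans (*-congˡ (zeroˡ _)) (zeroʳ _)
  tail-zero-suc i (suc N) k =
    trans (+-cong (trans (*-congˡ (zeroˡ _)) (zeroʳ _)) (tail-zero-suc (suc i) N k)) (+-identityʳ 0#)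

  V-zero-vanish : ∀ N k {r} → N ℕ.+ k ≡ suc r → V 0 N k ≡ + 0
  V-zero-vanish zero    (suc k) _ = ≡.refl
  V-zero-vanish (suc N) k       _ = ≡.refl

  -- The initial value g₀ = 1 has no terms of positive degree: its only nonzero summand is v⁰.
  tail-zero : ∀ N k {r} → N ℕ.+ k ≡ suc r → tail 0 0 N k ≈ 0#
  tail-zero N k e = begin
    tail 0 0 N k
      ≈⟨ tail-unfold 0 0 N k ⟩
    1# * (1# * ι (V 0 N k)) + shift (λ N → tail 0 1 N k) N
      ≈⟨ +-cong (trans (*-identityˡ _) (*-identityˡ _)) (shift-cong (λ N → tail-zero-suc 0 N k) N) ⟩
    ι (V 0 N k) + shift (λ _ → 0#) N
      ≈⟨ +-cong (trans (≡⇒≈ (≡.cong ι (V-zero-vanish N k e))) 0-homo) (shift-zero N) ⟩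
    0# + 0#
      ≈⟨ +-identityʳ 0# ⟩
    0# ∎
    where
    shift-zero : ∀ n → shift (λ _ → 0#) n ≈ 0#
    shift-zero zero    = refl
    shift-zero (suc n) = refl

  increment : (h N k : ℕ) → Carrier
  increment h N k = tail (suc h) 0 N k - tail h 0 N k

  -- `tail-rec` at i = 0, where the boundary vanishes because both Gaussian binomials are 1.
  increment-rec : ∀ h N k →
    increment h N k ≈ shift (tail (suc h) 0 N) k + (1# - q ^ suc h) * shift (λ N → increment (suc h) N k) N
  increment-rec h N k = begin
    tail (suc h) 0 N k - tail h 0 N k
      ≈⟨ +-congʳ (tail-rec h 0 N k) ⟩
    t + a + (1# - q ^ suc h) * (z₂ - z₁) + (1# - gauss h 0) * (1# * X 0 (h ℕ.+ 0) N k) - t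
      ≈⟨ +-congʳ (+-cong (+-congˡ (*-congˡ (sym (shift-diff N)))) (*-congʳ (trans (+-congˡ (-‿cong (≡⇒≈ (gauss-zeroʳ h)))) (-‿inverseʳ 1#)))) ⟩
    t + a + w + 0# * (1# * X 0 (h ℕ.+ 0) N k) - t
      ≈⟨ +-congʳ (trans (+-congˡ (zeroˡ _)) (+-identityʳ _)) ⟩
    t + a + w - t
      ≈⟨ +-comm _ _ ⟩
    - t + (t + a + w)
      ≈⟨ +-congˡ (+-assoc _ _ _) ⟩
    - t + (t + (a + w))
      ≈⟨ +-assoc _ _ _ ⟨
    - t + t + (a + w)
      ≈⟨ trans (+-congʳ (-‿inverseˡ t)) (+-identityˡ _) ⟩
    a + w ∎
    where
    t  = tail h 0 N k
    a  = shift (tail (suc h) 0 N) k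
    z₂ = shift (λ N → tail (suc (suc h)) 0 N k) N
    z₁ = shift (λ N → tail (suc h) 0 N k) N
    w  = (1# - q ^ suc h) * shift (λ N → increment (suc h) N k) N
    shift-diff : ∀ N → shift (λ N → increment (suc h) N k) N
      ≈ shift (λ N → tail (suc (suc h)) 0 N k) N - shift (λ N → tail (suc h) 0 N k) N
    shift-diff zero    = sym (-‿inverseʳ 0#)
    shift-diff (suc N) = refl

  -- Totals with h used letters belong to g_{h+1}. Dropping a used largest letter leaves h - 1 used
  -- letters, so those with a free largest letter belong to g_{h+1} - g_h. The recurrence of the
  -- totals then becomes that of the series, one factor 1 - q at a time, by (1 - q) [h + 1] = 1 -
  -- qʰ⁺¹.
  total-closed : ∀ r h N k → N ℕ.+ k ≡ r → (1# - q) ^ N * total (h ℕ.+ r) r k ≈ tail (suc h) 0 N k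
  totalFree-closed : ∀ r h N k → N ℕ.+ k ≡ suc r → (1# - q) ^ N * totalFree (h ℕ.+ r) r k ≈ increment h N k

  total-closed zero h zero zero _ = begin
    1# * total (h ℕ.+ 0) 0 0  ≈⟨ *-identityˡ _ ⟩
    total (h ℕ.+ 0) 0 0       ≈⟨ total-zero-zero (h ℕ.+ 0) ⟩
    1#                    ≈⟨ tail-first h ⟨
    tail (suc h) 0 0 0    ∎
  -- With no letter used, the largest one is free; correspondingly g₀ contributes nothing in
  -- positive degree.
  total-closed (suc r) zero N k e = begin
    (1# - q) ^ N * total (suc r) (suc r) k
      ≈⟨ *-congˡ (total-suc-suc r r k) ⟩
    (1# - q) ^ N * (total r (suc r) k + totalFree r r k)
      ≈⟨ *-congˡ (trans (+-congʳ (≡⇒≈ (≡.cong (λ Ps → ∑ Ps (λ P → W P (suc r) k)) (patterns-empty (ℕ.n<1+n r)))))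
           (+-identityˡ _)) ⟩
    (1# - q) ^ N * totalFree r r k
      ≈⟨ totalFree-closed r 0 N k e ⟩
    tail 1 0 N k - tail 0 0 N k
      ≈⟨ +-congˡ (-‿cong (tail-zero N k e)) ⟩
    tail 1 0 N k - 0#
      ≈⟨ +-congˡ (trans (sym (+-identityˡ _)) (-‿inverseʳ 0#)) ⟩
    tail 1 0 N k + 0#
      ≈⟨ +-identityʳ _ ⟩
    tail 1 0 N k ∎
  total-closed (suc r) (suc h) N k e = begin
    c * total (suc (h ℕ.+ suc r)) (suc r) k
      ≈⟨ trans (*-congˡ (total-suc-suc (h ℕ.+ suc r) r k)) (distribˡ _ _ _) ⟩
    c * total (h ℕ.+ suc r) (suc r) k + c * totalFree (h ℕ.+ suc r) r k
      ≡⟨ ≡.cong (λ m → c * total (h ℕ.+ suc r) (suc r) k + c * totalFree m r k) (ℕ.+-suc h r) ⟩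
    c * total (h ℕ.+ suc r) (suc r) k + c * totalFree (suc h ℕ.+ r) r k
      ≈⟨ +-cong (total-closed (suc r) h N k e) (totalFree-closed r (suc h) N k e) ⟩
    t + (tail (suc (suc h)) 0 N k - t)
      ≈⟨ trans (+-congˡ (+-comm _ _)) (sym (+-assoc _ _ _)) ⟩
    t - t + tail (suc (suc h)) 0 N k
      ≈⟨ trans (+-congʳ (-‿inverseʳ t)) (+-identityˡ _) ⟩
    tail (suc (suc h)) 0 N k ∎
    where
    c = (1# - q) ^ N
    t = tail (suc h) 0 N k

  totalFree-closed zero h zero (suc zero) _ = begin
    1# * totalFree (h ℕ.+ 0) 0 1               ≈⟨ *-congˡ (totalFree-zero (h ℕ.+ 0) 1) ⟩
    1# * total (h ℕ.+ 0) 0 0               ≈⟨ total-closed 0 h 0 0 ≡.refl ⟩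
    tail (suc h) 0 0 0                 ≈⟨ trans (+-congˡ (zeroʳ _)) (+-identityʳ _) ⟨
    tail (suc h) 0 0 0 + (1# - q ^ suc h) * 0# ≈⟨ increment-rec h 0 1 ⟨
    increment h 0 1                    ∎
  -- The only free letter is the largest and must be a right-to-left maximum; on the other side the
  -- two constant terms 1 cancel.
  totalFree-closed zero h (suc zero) zero _ = begin
    (1# - q) * 1# * totalFree (h ℕ.+ 0) 0 0    ≈⟨ trans (*-congˡ (totalFree-zero (h ℕ.+ 0) 0)) (zeroʳ _) ⟩
    0#                                 ≈⟨ zeroʳ _ ⟨
    (1# - q ^ suc h) * 0#              ≈⟨ *-congˡ (trans (+-cong (tail-first (suc h)) (-‿cong (tail-first h))) (-‿inverseʳ 1#)) ⟨
    (1# - q ^ suc h) * increment (suc h) 0 0 ≈⟨ +-identityˡ _ ⟨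
    0# + (1# - q ^ suc h) * increment (suc h) 0 0 ≈⟨ increment-rec h 1 0 ⟨
    increment h 1 0                    ∎
  totalFree-closed (suc r) h N k e = begin
    (1# - q) ^ N * totalFree (h ℕ.+ suc r) (suc r) k
      ≈⟨ *-congˡ (totalFree-suc (h ℕ.+ suc r) r k) ⟩
    (1# - q) ^ N * (shift (total (h ℕ.+ suc r) (suc r)) k + [ h ℕ.+ suc r ∸ r ] * totalFree (h ℕ.+ suc r) r k)
      ≡⟨ ≡.cong (λ m → (1# - q) ^ N * (shift (total (h ℕ.+ suc r) (suc r)) k + [ m ∸ r ] * totalFree m r k)) (ℕ.+-suc h r) ⟩
    (1# - q) ^ N * (shift (total (h ℕ.+ suc r) (suc r)) k + [ suc h ℕ.+ r ∸ r ] * totalFree (suc h ℕ.+ r) r k)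
      ≡⟨ ≡.cong (λ m → (1# - q) ^ N * (shift (total (h ℕ.+ suc r) (suc r)) k + [ m ] * totalFree (suc h ℕ.+ r) r k)) (ℕ.m+n∸n≡m (suc h) r) ⟩
    (1# - q) ^ N * (shift (total (h ℕ.+ suc r) (suc r)) k + [ suc h ] * totalFree (suc h ℕ.+ r) r k)
      ≈⟨ distribˡ _ _ _ ⟩
    (1# - q) ^ N * shift (total (h ℕ.+ suc r) (suc r)) k + (1# - q) ^ N * ([ suc h ] * totalFree (suc h ℕ.+ r) r k)
      ≈⟨ +-cong (tops k e) (others N e) ⟩
    shift (tail (suc h) 0 N) k + (1# - q ^ suc h) * shift (λ N → increment (suc h) N k) N
      ≈⟨ increment-rec h N k ⟨
    increment h N k ∎
    where
    tops : ∀ k → N ℕ.+ k ≡ suc (suc r) →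
      (1# - q) ^ N * shift (total (h ℕ.+ suc r) (suc r)) k ≈ shift (tail (suc h) 0 N) k
    tops zero    e = zeroʳ _
    tops (suc k) e = total-closed (suc r) h N k (ℕ.suc-injective (≡.trans (≡.sym (ℕ.+-suc N k)) e))
    others : ∀ N → N ℕ.+ k ≡ suc (suc r) →
      (1# - q) ^ N * ([ suc h ] * totalFree (suc h ℕ.+ r) r k)
        ≈ (1# - q ^ suc h) * shift (λ N → increment (suc h) N k) N
    -- Here k = r + 2 maxima are asked of r + 1 free letters.
    others zero e = begin
      1# * ([ suc h ] * totalFree (suc h ℕ.+ r) r k)
        ≈⟨ *-congˡ (*-congˡ (totalFree-vanish r (suc h ℕ.+ r) k (≡.subst (suc r <_) (≡.sym e) (ℕ.n<1+n (suc r))))) ⟩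
      1# * ([ suc h ] * 0#)    ≈⟨ trans (*-congˡ (zeroʳ _)) (zeroʳ _) ⟩
      0#                       ≈⟨ zeroʳ _ ⟨
      (1# - q ^ suc h) * 0#    ∎
    others (suc N) e = begin
      (1# - q) * (1# - q) ^ N * ([ suc h ] * totalFree (suc h ℕ.+ r) r k)
        ≈⟨ *-assoc _ _ _ ⟩
      (1# - q) * ((1# - q) ^ N * ([ suc h ] * totalFree (suc h ℕ.+ r) r k))
        ≈⟨ *-congˡ (trans (sym (*-assoc _ _ _)) (trans (*-congʳ (*-comm _ _)) (*-assoc _ _ _))) ⟩
      (1# - q) * ([ suc h ] * ((1# - q) ^ N * totalFree (suc h ℕ.+ r) r k))
        ≈⟨ *-assoc _ _ _ ⟨
      (1# - q) * [ suc h ] * ((1# - q) ^ N * totalFree (suc h ℕ.+ r) r k)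
        ≈⟨ *-cong ([1-q]*[] (suc h)) (totalFree-closed r (suc h) N k (ℕ.suc-injective e)) ⟩
      (1# - q ^ suc h) * increment (suc h) N k ∎

-- The commutative ring of coefficient lists.

module Polynomials where

  open Defs using (_≈_)
  open ≡ using (refl; sym; trans; cong; cong₂)

  coeff-⊕ : ∀ p r m → coeff (p ⊕ r) m ≡ coeff p m ℤ.+ coeff r m
  coeff-⊕ []      r       m       = sym (ℤ.+-identityˡ _)
  coeff-⊕ (a ∷ p) []      m       = sym (ℤ.+-identityʳ _)
  coeff-⊕ (a ∷ p) (b ∷ r) zero    = refl
  coeff-⊕ (a ∷ p) (b ∷ r) (suc m) = coeff-⊕ p r m

  coeff-· : ∀ c p m → coeff (c · p) m ≡ c ℤ.* coeff p m
  coeff-· c []      m       = sym (ℤ.*-zeroʳ c)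
  coeff-· c (a ∷ p) zero    = refl
  coeff-· c (a ∷ p) (suc m) = coeff-· c p m

  -- A record, so that the two polynomials can be inferred from a proof of their equality.
  infix 4 _≋_
  record _≋_ (p r : Poly) : Set where
    constructor pointwise
    field at : p ≈ r
  open _≋_ public

  ≋-refl : ∀ {p} → p ≋ p
  ≋-refl .at m = refl

  ≋-setoid : Setoid 0ℓ 0ℓ
  ≋-setoid = record
    { Carrier = Poly ; _≈_ = _≋_
    ; isEquivalence = record
      { refl = ≋-refl
      ; sym = λ e → pointwise λ m → sym (e .at m)
      ; trans = λ e f → pointwise λ m → trans (e .at m) (f .at m) } }

  open Setoid ≋-setoid using () renaming (trans to ≋-trans; sym to ≋-sym)
  open SetoidReasoning ≋-setoid

  ∷-cong : ∀ {a b p r} → a ≡ b → p ≋ r → (a ∷ p) ≋ (b ∷ r)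
  ∷-cong a≡b p≋r .at zero    = a≡b
  ∷-cong a≡b p≋r .at (suc m) = p≋r .at m

  0∷[]≋[] : (+ 0 ∷ []) ≋ []
  0∷[]≋[] .at zero    = refl
  0∷[]≋[] .at (suc m) = refl

  ⊕-cong : ∀ {p p′ r r′} → p ≋ p′ → r ≋ r′ → (p ⊕ r) ≋ (p′ ⊕ r′)
  ⊕-cong {p} {p′} {r} {r′} e f .at m
    rewrite coeff-⊕ p r m | coeff-⊕ p′ r′ m = cong₂ ℤ._+_ (e .at m) (f .at m)

  ⊕-congˡ : ∀ p {r s} → r ≋ s → (p ⊕ r) ≋ (p ⊕ s)
  ⊕-congˡ p = ⊕-cong (≋-refl {p})

  ⊕-assoc : ∀ p r s → ((p ⊕ r) ⊕ s) ≋ (p ⊕ (r ⊕ s))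
  ⊕-assoc p r s .at m
    rewrite coeff-⊕ (p ⊕ r) s m | coeff-⊕ p r m | coeff-⊕ p (r ⊕ s) m | coeff-⊕ r s m
    = ℤ.+-assoc (coeff p m) (coeff r m) (coeff s m)

  ⊕-comm : ∀ p r → (p ⊕ r) ≋ (r ⊕ p)
  ⊕-comm p r .at m rewrite coeff-⊕ p r m | coeff-⊕ r p m = ℤ.+-comm (coeff p m) (coeff r m)

  ⊕-identityʳ : ∀ p → (p ⊕ []) ≋ p
  ⊕-identityʳ []      .at m = refl
  ⊕-identityʳ (a ∷ p) .at m = refl

  ⊕-interchange : ∀ p r s t → ((p ⊕ r) ⊕ (s ⊕ t)) ≋ ((p ⊕ s) ⊕ (r ⊕ t))
  ⊕-interchange p r s t .at m
    rewrite coeff-⊕ (p ⊕ r) (s ⊕ t) m | coeff-⊕ p r m | coeff-⊕ s t m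
          | coeff-⊕ (p ⊕ s) (r ⊕ t) m | coeff-⊕ p s m | coeff-⊕ r t m
    = solve 4 (λ a b c d → (a :+ b) :+ (c :+ d) := (a :+ c) :+ (b :+ d)) refl
        (coeff p m) (coeff r m) (coeff s m) (coeff t m)
    where open +-*-Solver

  ·-cong : ∀ a {p r} → p ≋ r → (a · p) ≋ (a · r)
  ·-cong a {p} {r} e .at m rewrite coeff-· a p m | coeff-· a r m = cong (a ℤ.*_) (e .at m)

  ·-distribˡ-⊕ : ∀ a p r → (a · (p ⊕ r)) ≋ ((a · p) ⊕ (a · r))
  ·-distribˡ-⊕ a p r .at m
    rewrite coeff-· a (p ⊕ r) m | coeff-⊕ p r m | coeff-⊕ (a · p) (a · r) m
          | coeff-· a p m | coeff-· a r m
    = ℤ.*-distribˡ-+ a (coeff p m) (coeff r m)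

  ·-assoc : ∀ a b p → ((a ℤ.* b) · p) ≋ (a · (b · p))
  ·-assoc a b p .at m
    rewrite coeff-· (a ℤ.* b) p m | coeff-· a (b · p) m | coeff-· b p m
    = ℤ.*-assoc a b (coeff p m)

  ·-zeroˡ : ∀ p → (+ 0 · p) ≋ []
  ·-zeroˡ p .at m rewrite coeff-· (+ 0) p m = ℤ.*-zeroˡ (coeff p m)

  ·-identityˡ : ∀ p → (+ 1 · p) ≋ p
  ·-identityˡ p .at m rewrite coeff-· (+ 1) p m = ℤ.*-identityˡ (coeff p m)

  ·-0∷ : ∀ a p → (a · (+ 0 ∷ p)) ≋ (+ 0 ∷ (a · p))
  ·-0∷ a p = ∷-cong (ℤ.*-zeroʳ a) ≋-refl

  ⊗-congˡ : ∀ p {r s} → r ≋ s → (p ⊗ r) ≋ (p ⊗ s)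
  ⊗-congˡ []      e = ≋-refl
  ⊗-congˡ (a ∷ p) {r} {s} e =
    ⊕-cong (·-cong a e) (∷-cong refl (⊗-congˡ p e))

  ⊗-zeroʳ : ∀ p → (p ⊗ []) ≋ []
  ⊗-zeroʳ []      .at m       = refl
  ⊗-zeroʳ (a ∷ p) .at zero    = refl
  ⊗-zeroʳ (a ∷ p) .at (suc m) = ⊗-zeroʳ p .at m

  ⊗-∷ : ∀ r a p → (r ⊗ (a ∷ p)) ≋ ((a · r) ⊕ (+ 0 ∷ (r ⊗ p)))
  ⊗-∷ []      a p = pointwise λ { zero → refl ; (suc m) → refl }
  ⊗-∷ (b ∷ r) a p = begin
    (b · (a ∷ p)) ⊕ (+ 0 ∷ (r ⊗ (a ∷ p)))
      ≈⟨ ⊕-congˡ (b · (a ∷ p)) (∷-cong refl (⊗-∷ r a p)) ⟩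
    (b ℤ.* a ∷ b · p) ⊕ (+ 0 ∷ ((a · r) ⊕ (+ 0 ∷ (r ⊗ p))))
      ≈⟨ ∷-cong (cong (ℤ._+ + 0) (ℤ.*-comm b a)) swap ⟩
    (a ℤ.* b ∷ a · r) ⊕ (+ 0 ∷ ((b · p) ⊕ (+ 0 ∷ (r ⊗ p)))) ∎
    where
    t = + 0 ∷ (r ⊗ p)
    swap : ((b · p) ⊕ ((a · r) ⊕ t)) ≋ ((a · r) ⊕ ((b · p) ⊕ t))
    swap = begin
      (b · p) ⊕ ((a · r) ⊕ t) ≈⟨ ⊕-assoc (b · p) (a · r) t ⟨
      ((b · p) ⊕ (a · r)) ⊕ t ≈⟨ ⊕-cong (⊕-comm (b · p) (a · r)) ≋-refl ⟩
      ((a · r) ⊕ (b · p)) ⊕ t ≈⟨ ⊕-assoc (a · r) (b · p) t ⟩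
      (a · r) ⊕ ((b · p) ⊕ t) ∎

  ⊗-comm : ∀ p r → (p ⊗ r) ≋ (r ⊗ p)
  ⊗-comm []      r = pointwise λ m → sym (⊗-zeroʳ r .at m)
  ⊗-comm (a ∷ p) r = begin
    (a · r) ⊕ (+ 0 ∷ (p ⊗ r)) ≈⟨ ⊕-congˡ (a · r) (∷-cong refl (⊗-comm p r)) ⟩
    (a · r) ⊕ (+ 0 ∷ (r ⊗ p)) ≈⟨ ⊗-∷ r a p ⟨
    r ⊗ (a ∷ p)               ∎

  ⊗-congʳ : ∀ {p r} s → p ≋ r → (p ⊗ s) ≋ (r ⊗ s)
  ⊗-congʳ {p} {r} s e = begin
    p ⊗ s ≈⟨ ⊗-comm p s ⟩
    s ⊗ p ≈⟨ ⊗-congˡ s e ⟩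
    s ⊗ r ≈⟨ ⊗-comm s r ⟩
    r ⊗ s ∎

  ⊗-distribˡ-⊕ : ∀ p r s → (p ⊗ (r ⊕ s)) ≋ ((p ⊗ r) ⊕ (p ⊗ s))
  ⊗-distribˡ-⊕ []      r s = ≋-refl
  ⊗-distribˡ-⊕ (a ∷ p) r s = begin
    (a · (r ⊕ s)) ⊕ (+ 0 ∷ (p ⊗ (r ⊕ s)))
      ≈⟨ ⊕-cong (·-distribˡ-⊕ a r s) (∷-cong refl (⊗-distribˡ-⊕ p r s)) ⟩
    ((a · r) ⊕ (a · s)) ⊕ ((+ 0 ∷ (p ⊗ r)) ⊕ (+ 0 ∷ (p ⊗ s)))
      ≈⟨ ⊕-interchange (a · r) (a · s) (+ 0 ∷ (p ⊗ r)) (+ 0 ∷ (p ⊗ s)) ⟩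
    ((a · r) ⊕ (+ 0 ∷ (p ⊗ r))) ⊕ ((a · s) ⊕ (+ 0 ∷ (p ⊗ s))) ∎

  ⊗-distribʳ-⊕ : ∀ s p r → ((p ⊕ r) ⊗ s) ≋ ((p ⊗ s) ⊕ (r ⊗ s))
  ⊗-distribʳ-⊕ s p r = begin
    (p ⊕ r) ⊗ s         ≈⟨ ⊗-comm (p ⊕ r) s ⟩
    s ⊗ (p ⊕ r)         ≈⟨ ⊗-distribˡ-⊕ s p r ⟩
    (s ⊗ p) ⊕ (s ⊗ r)   ≈⟨ ⊕-cong (⊗-comm s p) (⊗-comm s r) ⟩
    (p ⊗ s) ⊕ (r ⊗ s)   ∎

  ·-⊗ : ∀ a p r → ((a · p) ⊗ r) ≋ (a · (p ⊗ r))
  ·-⊗ a []      r = ≋-refl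
  ·-⊗ a (b ∷ p) r = begin
    ((a ℤ.* b) · r) ⊕ (+ 0 ∷ ((a · p) ⊗ r))
      ≈⟨ ⊕-cong (·-assoc a b r) (∷-cong refl (·-⊗ a p r)) ⟩
    (a · (b · r)) ⊕ (+ 0 ∷ (a · (p ⊗ r)))
      ≈⟨ ⊕-congˡ (a · (b · r)) (·-0∷ a (p ⊗ r)) ⟨
    (a · (b · r)) ⊕ (a · (+ 0 ∷ (p ⊗ r)))
      ≈⟨ ·-distribˡ-⊕ a (b · r) (+ 0 ∷ (p ⊗ r)) ⟨
    a · ((b · r) ⊕ (+ 0 ∷ (p ⊗ r))) ∎

  0∷-⊗ : ∀ p r → ((+ 0 ∷ p) ⊗ r) ≋ (+ 0 ∷ (p ⊗ r))
  0∷-⊗ p r = ⊕-cong (·-zeroˡ r) ≋-refl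

  ⊗-assoc : ∀ p r s → ((p ⊗ r) ⊗ s) ≋ (p ⊗ (r ⊗ s))
  ⊗-assoc []      r s = ≋-refl
  ⊗-assoc (a ∷ p) r s = begin
    ((a · r) ⊕ (+ 0 ∷ (p ⊗ r))) ⊗ s
      ≈⟨ ⊗-distribʳ-⊕ s (a · r) (+ 0 ∷ (p ⊗ r)) ⟩
    ((a · r) ⊗ s) ⊕ ((+ 0 ∷ (p ⊗ r)) ⊗ s)
      ≈⟨ ⊕-cong (·-⊗ a r s) (0∷-⊗ (p ⊗ r) s) ⟩
    (a · (r ⊗ s)) ⊕ (+ 0 ∷ ((p ⊗ r) ⊗ s))
      ≈⟨ ⊕-congˡ (a · (r ⊗ s)) (∷-cong refl (⊗-assoc p r s)) ⟩
    (a · (r ⊗ s)) ⊕ (+ 0 ∷ (p ⊗ (r ⊗ s))) ∎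

  const-⊗ : ∀ c p → (const c ⊗ p) ≋ (c · p)
  const-⊗ c p = begin
    (c · p) ⊕ (+ 0 ∷ []) ≈⟨ ⊕-congˡ (c · p) 0∷[]≋[] ⟩
    (c · p) ⊕ []         ≈⟨ ⊕-identityʳ (c · p) ⟩
    c · p                ∎

  ⊗-identityˡ : ∀ p → (one ⊗ p) ≋ p
  ⊗-identityˡ p = begin
    one ⊗ p ≈⟨ const-⊗ (+ 1) p ⟩
    + 1 · p ≈⟨ ·-identityˡ p ⟩
    p       ∎

  ⊖_ : Poly → Poly
  ⊖ p = ℤ.- + 1 · p

  ⊖-inverseʳ : ∀ p → (p ⊕ (⊖ p)) ≋ []
  ⊖-inverseʳ p .at m rewrite coeff-⊕ p (⊖ p) m | coeff-· (ℤ.- + 1) p m =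
    solve 1 (λ a → a :+ con (ℤ.- + 1) :* a := con (+ 0)) refl (coeff p m)
    where open +-*-Solver

  polyRing : CommutativeRing 0ℓ 0ℓ
  polyRing = record
    { Carrier = Poly ; _≈_ = _≋_ ; _+_ = _⊕_ ; _*_ = _⊗_ ; -_ = ⊖_ ; 0# = [] ; 1# = one
    ; isCommutativeRing = record
      { isRing = record
        { +-isAbelianGroup = record
          { isGroup = record
            { isMonoid = record
              { isSemigroup = record
                { isMagma = record
                  { isEquivalence = Setoid.isEquivalence ≋-setoid
                  ; ∙-cong = ⊕-cong }
                ; assoc = ⊕-assoc }
              ; identity = (λ p → ≋-refl) , ⊕-identityʳ }
            ; inverse = (λ p → ≋-trans (⊕-comm (⊖ p) p) (⊖-inverseʳ p)) , ⊖-inverseʳ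
            ; ⁻¹-cong = ·-cong (ℤ.- + 1) }
          ; comm = ⊕-comm }
        ; *-cong = λ {p} {p′} {r} e f → ≋-trans (⊗-congʳ r e) (⊗-congˡ p′ f)
        ; *-assoc = ⊗-assoc
        ; *-identity = ⊗-identityˡ , (λ p → ≋-trans (⊗-comm p one) (⊗-identityˡ p))
        ; distrib = ⊗-distribˡ-⊕ , ⊗-distribʳ-⊕ }
      ; *-comm = ⊗-comm } }

  -- Cancellation of polynomials with constant coefficient 1.

  coeff-⊗-zero : ∀ p r → coeff (p ⊗ r) 0 ≡ coeff p 0 ℤ.* coeff r 0
  coeff-⊗-zero []      r = sym (ℤ.*-zeroˡ (coeff r 0))
  coeff-⊗-zero (a ∷ p) r = trans (coeff-⊕ (a · r) (+ 0 ∷ (p ⊗ r)) 0) (trans (ℤ.+-identityʳ _) (coeff-· a r 0))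

  -- The lowest coefficient of the product is that of `t`, so it vanishes; removing it leaves the
  -- same situation one degree higher.
  ⊗-cancelˡ-[] : ∀ p t → coeff p 0 ≡ + 1 → p ⊗ t ≋ [] → t ≋ []
  ⊗-cancelˡ-[] p []      p₀ e = ≋-refl
  ⊗-cancelˡ-[] p (a ∷ t) p₀ e = begin
    a ∷ t  ≈⟨ ∷-cong a≡0 (⊗-cancelˡ-[] p t p₀ (pointwise λ m → trans (sym (shifted .at (suc m))) (e .at (suc m)))) ⟩
    + 0 ∷ [] ≈⟨ 0∷[]≋[] ⟩
    []     ∎
    where
    a≡0 : a ≡ + 0
    a≡0 = trans (sym (trans (coeff-⊗-zero p (a ∷ t)) (trans (cong (ℤ._* a) p₀) (ℤ.*-identityˡ a)))) (e .at 0)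
    shifted : p ⊗ (a ∷ t) ≋ + 0 ∷ (p ⊗ t)
    shifted = begin
      p ⊗ (a ∷ t)               ≈⟨ ⊗-∷ p a t ⟩
      (a · p) ⊕ (+ 0 ∷ (p ⊗ t)) ≡⟨ cong (λ c → (c · p) ⊕ (+ 0 ∷ (p ⊗ t))) a≡0 ⟩
      (+ 0 · p) ⊕ (+ 0 ∷ (p ⊗ t)) ≈⟨ ⊕-cong (·-zeroˡ p) ≋-refl ⟩
      + 0 ∷ (p ⊗ t)             ∎

  ⊗-cancelˡ : ∀ p r s → coeff p 0 ≡ + 1 → p ⊗ r ≋ p ⊗ s → r ≋ s
  ⊗-cancelˡ p r s p₀ e = begin
    r                ≈⟨ ⊕-identityʳ r ⟨
    r ⊕ []           ≈⟨ ⊕-congˡ r (≋-trans (⊕-comm (⊖ s) s) (⊖-inverseʳ s)) ⟨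
    r ⊕ ((⊖ s) ⊕ s)  ≈⟨ ⊕-assoc r (⊖ s) s ⟨
    (r ⊕ (⊖ s)) ⊕ s  ≈⟨ ⊕-cong (⊗-cancelˡ-[] p (r ⊕ (⊖ s)) p₀ difference) (≋-refl {s}) ⟩
    s                ∎
    where
    difference : p ⊗ (r ⊕ (⊖ s)) ≋ []
    difference = begin
      p ⊗ (r ⊕ (⊖ s))           ≈⟨ ⊗-distribˡ-⊕ p r (⊖ s) ⟩
      (p ⊗ r) ⊕ (p ⊗ (⊖ s))     ≈⟨ ⊕-cong e (≋-trans (⊗-comm p (⊖ s)) (≋-trans (·-⊗ (ℤ.- + 1) s p) (·-cong (ℤ.- + 1) (⊗-comm s p)))) ⟩
      (p ⊗ s) ⊕ (⊖ (p ⊗ s))     ≈⟨ ⊖-inverseʳ (p ⊗ s) ⟩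
      []                        ∎

  constants : ℤ.+-*-rawRing -Raw-AlmostCommutative⟶ fromCommutativeRing polyRing
  constants = record
    { ⟦_⟧    = const
    ; +-homo = λ a b → ≋-refl
    ; *-homo = λ a b → ≋-sym (const-⊗ a (const b))
    ; -‿homo = λ a → ∷-cong (sym (ℤ.-1*i≡-i a)) ≋-refl
    ; 0-homo = 0∷[]≋[]
    ; 1-homo = ≋-refl
    }

  q : Poly
  q = + 0 ∷ one

  open QSeries polyRing constants q using ([_]; [_]!; gauss; gauss-factorials; []-suc; total; total-closed; tail; ∑-perms; tail-double-sum; ∑-upTo-last; ∑-upTo-cong)
  open Sums polyRing using (∑; ∑-map; ∑-cong)
  open Algebra.Properties.Semiring.Exp (CommutativeRing.semiring polyRing) using () renaming (_^_ to _^ᴾ_)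

  -- Specialisation of the series identity to polynomials.

  qpow-^ : ∀ m → qpow m ≋ q ^ᴾ m
  qpow-^ zero    = ≋-refl
  qpow-^ (suc m) = begin
    + 0 ∷ qpow m       ≈⟨ ∷-cong refl (qpow-^ m) ⟩
    + 0 ∷ (q ^ᴾ m)     ≈⟨ ∷-cong refl (⊗-identityˡ (q ^ᴾ m)) ⟨
    + 0 ∷ (one ⊗ (q ^ᴾ m)) ≈⟨ 0∷-⊗ one (q ^ᴾ m) ⟨
    q ⊗ (q ^ᴾ m)       ∎

  ^ₚ-^ : ∀ p m → p ^ₚ m ≡ p ^ᴾ m
  ^ₚ-^ p zero    = refl
  ^ₚ-^ p (suc m) = cong (p ⊗_) (^ₚ-^ p m)

  qint-[] : ∀ n → qint n ≋ [ n ]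
  qint-[] zero    = ≋-refl
  qint-[] (suc n) = ≋-trans (∑-upTo-last n qpow) (⊕-cong (qint-[] n) (qpow-^ n))

  qfact-! : ∀ n → qfact n ≋ [ n ]!
  qfact-! zero    = ≋-refl
  qfact-! (suc n) = ≋-trans (⊗-congʳ (qfact n) (qint-[] (suc n))) (⊗-congˡ [ suc n ] (qfact-! n))

  -- From [n + 1] = 1 + q [n]; it makes the q-factorials cancellable.
  coeff-qfact : ∀ n → coeff (qfact n) 0 ≡ + 1
  coeff-qfact zero    = refl
  coeff-qfact (suc n) = trans (coeff-⊗-zero (qint (suc n)) (qfact n))
    (cong₂ ℤ._*_ (trans (qint-[] (suc n) .at 0) (trans ([]-suc n .at 0) constant)) (coeff-qfact n))
    where
    constant : coeff (one ⊕ (q ⊗ [ n ])) 0 ≡ + 1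
    constant = trans (coeff-⊕ one (q ⊗ [ n ]) 0) (cong (ℤ._+_ (+ 1)) (trans (coeff-⊗-zero q [ n ]) (ℤ.*-zeroˡ (coeff [ n ] 0))))

  module _ (Qb : ℕ → ℕ → Poly) (isQBinom : IsQBinom Qb) where

    -- Both sides satisfy the factorial equation that characterises the quotient, and the
    -- q-factorials cancel.
    Qb-gauss : ∀ j d → Qb (j ℕ.+ d) j ≋ gauss (suc d) j
    Qb-gauss j d = ⊗-cancelˡ (qfact j ⊗ qfact d) (Qb (j ℕ.+ d) j) (gauss (suc d) j)
      (trans (coeff-⊗-zero (qfact j) (qfact d)) (cong₂ ℤ._*_ (coeff-qfact j) (coeff-qfact d)))
      (begin
        qfact j ⊗ qfact d ⊗ Qb (j ℕ.+ d) j
          ≡⟨ cong (λ e → qfact j ⊗ qfact e ⊗ Qb (j ℕ.+ d) j) (ℕ.m+n∸m≡n j d) ⟨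
        qfact j ⊗ qfact (j ℕ.+ d ∸ j) ⊗ Qb (j ℕ.+ d) j
          ≈⟨ pointwise (isQBinom (j ℕ.+ d) j (ℕ.m≤m+n j d)) ⟩
        qfact (j ℕ.+ d)
          ≡⟨ cong qfact (ℕ.+-comm j d) ⟩
        qfact (d ℕ.+ j)
          ≈⟨ qfact-! (d ℕ.+ j) ⟩
        [ d ℕ.+ j ]!
          ≈⟨ gauss-factorials d j ⟨
        [ j ]! ⊗ [ d ]! ⊗ gauss (suc d) j
          ≈⟨ ⊗-congʳ (gauss (suc d) j) (≋-trans (⊗-congʳ (qfact d) (qfact-! j)) (⊗-congˡ [ j ]! (qfact-! d))) ⟨
        qfact j ⊗ qfact d ⊗ gauss (suc d) j ∎)

    summand-≋ : ∀ n k j d → k ℕ.≤ n → j ℕ.+ d ℕ.≤ n ∸ k →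
      (-1ℤ ℤ.^ j ℤ.* B (+ (n ℕ.+ 1)) (+ (k ℕ.+ 1)) (+ (j ℕ.+ d)) (+ j))
          · (qpow (j ℕ.+ d ℕ.+ (j C 2)) ⊗ Qb (j ℕ.+ d) j)
        ≋ const (-1ℤ ℤ.^ j) ⊗ const (V (suc (j ℕ.+ d ℕ.+ j)) (n ∸ k ∸ (j ℕ.+ d)) k)
          ⊗ ((q ^ᴾ (j ℕ.+ d ℕ.+ (j C 2))) ⊗ gauss (suc d) j)
    summand-≋ n k j d k≤n i≤n-k = begin
      (s ℤ.* B (+ (n ℕ.+ 1)) (+ (k ℕ.+ 1)) (+ i) (+ j)) · p
        ≡⟨ cong (λ b → (s ℤ.* b) · p) (trans (cong (λ n → B (+ (n ℕ.+ 1)) (+ (k ℕ.+ 1)) (+ i) (+ j)) n≡) (B≡V N k i j)) ⟩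
      (s ℤ.* b) · p
        ≈⟨ const-⊗ (s ℤ.* b) p ⟨
      const (s ℤ.* b) ⊗ p
        ≈⟨ ⊗-congʳ p (≋-sym (const-⊗ s (const b))) ⟩
      const s ⊗ const b ⊗ p
        ≈⟨ ⊗-congˡ (const s ⊗ const b) (≋-trans (⊗-congʳ (Qb i j) (qpow-^ (i ℕ.+ (j C 2)))) (⊗-congˡ (q ^ᴾ (i ℕ.+ (j C 2))) (Qb-gauss j d))) ⟩
      const s ⊗ const b ⊗ ((q ^ᴾ (i ℕ.+ (j C 2))) ⊗ gauss (suc d) j) ∎
      where
      i = j ℕ.+ d
      N = n ∸ k ∸ i
      s = -1ℤ ℤ.^ j
      b = V (suc (i ℕ.+ j)) N k
      p = qpow (i ℕ.+ (j C 2)) ⊗ Qb i j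
      n≡ : n ≡ N ℕ.+ k ℕ.+ i
      n≡ = sym (trans (ℕ.+-assoc N k i) (trans (cong (N ℕ.+_) (ℕ.+-comm k i))
        (trans (sym (ℕ.+-assoc N i k)) (trans (cong (ℕ._+ k) (ℕ.m∸n+n≡m i≤n-k)) (ℕ.m∸n+n≡m k≤n)))))

    S₁-formula : ∀ n k → k ℕ.≤ n →
      (oneMinusQ ^ₚ (n ∸ k)) ⊗ S₁ n k
        ≋ sumₚ (map (λ j → sumₚ (map (λ i →
              ((-1ℤ ℤ.^ j) ℤ.* B (+ (n ℕ.+ 1)) (+ (k ℕ.+ 1)) (+ i) (+ j))
                · (qpow (i ℕ.+ (j C 2)) ⊗ Qb i j))
            (range j (n ∸ k))))
          (range 0 (n ∸ k)))
    S₁-formula n k k≤n = begin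
      (oneMinusQ ^ₚ N) ⊗ S₁ n k
        ≡⟨ cong (_⊗ S₁ n k) (^ₚ-^ oneMinusQ N) ⟩
      (oneMinusQ ^ᴾ N) ⊗ S₁ n k
        ≈⟨ ⊗-congˡ (oneMinusQ ^ᴾ N) (≋-trans (∑-cong (filter (λ σ → rlm σ ℕ.≟ k) (perms n)) (λ σ → qpow-^ (inv′ σ))) (∑-perms n k)) ⟩
      (oneMinusQ ^ᴾ N) ⊗ total n n k
        -- Initially no letter is used, so h = 0 and the series is g₁.
        ≈⟨ total-closed n 0 N k (ℕ.m∸n+n≡m k≤n) ⟩
      tail 1 0 N k
        ≈⟨ tail-double-sum N k ⟩
      ∑ (upTo (suc N)) (λ j → ∑ (upTo (suc N ∸ j)) (λ d →
        const (-1ℤ ℤ.^ j) ⊗ const (V (suc (j ℕ.+ d ℕ.+ j)) (N ∸ (j ℕ.+ d)) k)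
          ⊗ ((q ^ᴾ (j ℕ.+ d ℕ.+ (j C 2))) ⊗ gauss (suc d) j)))
        ≈⟨ ∑-upTo-cong (suc N) (λ j j≤N → ∑-upTo-cong (suc N ∸ j) (λ d d≤N-j →
             summand-≋ n k j d k≤n (bound j d j≤N d≤N-j))) ⟨
      ∑ (upTo (suc N)) (λ j → ∑ (upTo (suc N ∸ j)) (λ d → term (j ℕ.+ d) j))
        ≈⟨ ∑-cong (upTo (suc N)) (λ j → ≡⇒≋ (∑-map (λ i → term i j) (j ℕ.+_) (upTo (suc N ∸ j)))) ⟨
      ∑ (upTo (suc N)) (λ j → ∑ (range j N) (λ i → term i j))
        ≡⟨ ∑-map (λ j → ∑ (range j N) (λ i → term i j)) (0 ℕ.+_) (upTo (suc N)) ⟨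
      ∑ (range 0 N) (λ j → ∑ (range j N) (λ i → term i j)) ∎
      where
      N = n ∸ k
      term : ℕ → ℕ → Poly
      term i j = ((-1ℤ ℤ.^ j) ℤ.* B (+ (n ℕ.+ 1)) (+ (k ℕ.+ 1)) (+ i) (+ j)) · (qpow (i ℕ.+ (j C 2)) ⊗ Qb i j)
      ≡⇒≋ : ∀ {p r} → p ≡ r → p ≋ r
      ≡⇒≋ refl = ≋-refl
      bound : ∀ j d → j ℕ.< suc N → d ℕ.< suc N ∸ j → j ℕ.+ d ℕ.≤ N
      bound j d (s≤s j≤N) d< rewrite ℕ.+-∸-assoc 1 j≤N = ℕ.≤-trans (ℕ.+-monoʳ-≤ j (ℕ.s≤s⁻¹ d<)) (ℕ.≤-reflexive (ℕ.m+[n∸m]≡n j≤N))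


open Polynomials using (_≋_; S₁-formula)
open import Defs using (_≈_)
open import Data.Nat using (_+_)
open import Data.Integer using (_^_)

theorem5p6 : (Qb : ℕ → ℕ → Poly) → IsQBinom Qb →
    ∀ (n k : ℕ) → k ≤ n →
    (oneMinusQ ^ₚ (n ∸ k)) ⊗ S₁ n k
    ≈ sumₚ (map (λ j → sumₚ (map (λ i →
    ((-1ℤ ^ j) Data.Integer.* B (+ (n + 1)) (+ (k + 1)) (+ i) (+ j))
    · (qpow (i + (j C 2)) ⊗ Qb i j))
    (range j (n ∸ k))))
    (range 0 (n ∸ k)))
theorem5p6 Qb isQBinom n k k≤n = S₁-formula Qb isQBinom n k k≤n ._≋_.at
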